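{- Let $G=(V,E)$ be a finite graph with $n$ vertices and maximum degree $\Delta$. Run the Persistent Decentralized Coloring algorithm on $G$ (random initial coloring, uniformly random choice of conflicted vertex, as described in the context). Then the algorithm terminates with a proper vertex coloring using colors from $\{1,\dots,\Delta+1\}$, and the expected total number of recolorings is $O(n\log\Delta)$.
   Context: A vertex $v$ is conflicted under a coloring $\chi$ if some neighbor $u$ of $v$ has $\chi(u)=\chi(v)$. The Persistent Decentralized Coloring algorithm maintains a coloring $\chi_t:V\to\{1,\dots,\Delta+1\}$: (1) initially each vertex independently chooses a uniformly random color from $\{1,\dots,\Delta+1\}$; (2) at each time step, a vertex $v$ is chosen uniformly at random among all currently conflicted vertices; (3) while $v$ is conflicted, $v$ repeatedly changes its color to an independent uniformly random color in $\{1,\dots,\Delta+1\}$ (each such change is one recoloring); (4) steps (2)–(3) repeat until no vertex is conflicted. The expectation is over the random initial coloring, the random choices of conflicted vertices, and the random new colors. -}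

module Defs where

open import Data.Nat using (ℕ; zero; suc; _⊔_)
open import Data.Bool using (Bool; true; false; if_then_else_; _∧_)
open import Data.Fin using (Fin; _≟_)
open import Data.List using (List; []; _∷_; map; length; filter; foldr; concatMap)
open import Data.Bool.ListAction using (any)
open import Data.List.Base using (allFin)
open import Data.Integer using (+_)
open import Data.Rational using (ℚ; 0ℚ; 1ℚ; _+_; _*_; _/_)
open import Relation.Nullary.Decidable using (⌊_⌋)
open import Relation.Binary.PropositionalEquality using (_≡_)

record Graph (n : ℕ) : Set where
  field
    adj    : Fin n → Fin n → Bool
    sym    : ∀ u v → adj u v ≡ adj v u
    irrefl : ∀ v → adj v v ≡ false
open Graph public

degree : ∀ {n} → Graph n → Fin n → ℕ
degree {n} G v = length (filter (λ u → adj G v u Data.Bool.≟ true) (allFin n))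

maxDegree : ∀ {n} → Graph n → ℕ
maxDegree {n} G = foldr _⊔_ 0 (map (degree G) (allFin n))

Coloring : ∀ {n} → Graph n → Set
Coloring {n} G = Fin n → Fin (suc (maxDegree G))

conflicted : ∀ {n} (G : Graph n) → Coloring G → Fin n → Bool
conflicted {n} G χ v = any (λ u → adj G v u ∧ ⌊ χ u ≟ χ v ⌋) (allFin n)

conflictedVertices : ∀ {n} (G : Graph n) → Coloring G → List (Fin n)
conflictedVertices {n} G χ = filter (λ v → conflicted G χ v Data.Bool.≟ true) (allFin n)

update : ∀ {n} (G : Graph n) → Coloring G → Fin n → Fin (suc (maxDegree G)) → Coloring G
update G χ v c u = if ⌊ u ≟ v ⌋ then c else χ u

sumℚ : List ℚ → ℚ
sumℚ = foldr _+_ 0ℚ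

avg : List ℚ → ℚ
avg []       = 0ℚ
avg (x ∷ xs) = sumℚ (x ∷ xs) * ((+ 1) / suc (length xs))

allFuns : (n m : ℕ) → List (Fin n → Fin m)
allFuns zero    m = (λ ()) ∷ []
allFuns (suc n) m =
  concatMap (λ c → map (λ f → λ { Fin.zero → c ; (Fin.suc i) → f i }) (allFuns n m)) (allFin m)

-- Truncated expected number of recolorings, E[min(R, k)], of the Persistent
-- Decentralized Coloring process.
--   outer k χ   : expectation from coloring χ at the start of a step (2)
--   inner k χ v : expectation while the chosen vertex v is (still) conflicted, step (3)
-- k is the remaining budget of recolorings counted.
mutual
  outer : ∀ {n} (G : Graph n) → ℕ → Coloring G → ℚ
  outer G k χ = avg (map (inner G k χ) (conflictedVertices G χ))

  inner : ∀ {n} (G : Graph n) → ℕ → Coloring G → Fin n → ℚ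
  inner G zero    χ v = 0ℚ
  inner G (suc k) χ v =
    1ℚ + avg (map (λ c → next (update G χ v c)) (allFin (suc (maxDegree G))))
    where
      next : Coloring G → ℚ
      next χ' = if conflicted G χ' v then inner G k χ' v else outer G k χ'

truncatedExpectedRecolorings : ∀ {n} (G : Graph n) → ℕ → ℚ
truncatedExpectedRecolorings {n} G k = avg (map (outer G k) (allFuns n (suc (maxDegree G))))

{-# OPTIONS --safe #-}
module Submission where

open import Defs renaming (sym to adj-sym; irrefl to adj-irrefl)
open import Data.Nat using (ℕ; suc; _*_)
open import Data.Nat.Logarithm using (⌊log₂_⌋)
open import Data.Integer using (+_)
open import Data.Rational using (_≤_; _/_)
open import Data.Product using (∃)

open import Data.Bool using (Bool; true; false; if_then_else_; not; _∧_; T)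
import Data.Bool as Bool
import Data.Bool.Properties as Bool
open import Data.Empty using (⊥-elim)
open import Data.Fin using (Fin; zero; suc)
import Data.Fin as Fin
import Data.Integer.Properties as ℤ
open import Data.List using (List; []; _∷_; map; length; filter; concatMap; allFin; _++_)
import Data.List.Properties as List
open import Data.List.Membership.Propositional using (_∈_; find; lose)
open import Data.List.Membership.Propositional.Properties using (∈-map⁺; ∈-map⁻; ∈-filter⁺; ∈-filter⁻; ∈-allFin)
import Data.List.Membership.DecPropositional as DecMembership
import Data.List.Relation.Unary.All as All
open import Data.List.Relation.Unary.AllPairs using ([]; _∷_)
open import Data.List.Relation.Unary.Any using (here; there)
open import Data.List.Relation.Unary.Any.Properties using (any⁺; any⁻)
open import Data.List.Relation.Unary.Unique.Propositional using (Unique)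
import Data.List.Relation.Unary.Unique.Propositional.Properties as Unique
open import Data.Nat using (zero; ⌊_/2⌋)
import Data.Nat as ℕ
import Data.Nat.Properties as ℕ
open import Data.Product using (_,_; _×_; proj₁; proj₂)
open import Data.Rational using (ℚ; 0ℚ; 1ℚ; _+_; -_; _-_; toℚᵘ; nonNegative)
import Data.Rational as ℚ
open import Data.Rational.Properties as ℚ using (≤-refl; ≤-trans; ≤-reflexive; +-mono-≤; module ≤-Reasoning)
open import Data.Rational.Solver using (module +-*-Solver)
open import Data.Rational.Unnormalised using (mkℚᵘ; *≡*; *≤*)
import Data.Rational.Unnormalised as ℚᵘ
import Data.Rational.Unnormalised.Properties as ℚᵘ
import Data.Vec.Functional as Vector
open import Data.Vec.Functional.Properties using (updateAt-updates; updateAt-minimal)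
open import Function using (_∘_; id)
open import Relation.Nullary using (Dec; yes; no; does)
open import Relation.Nullary.Decidable using (⌊_⌋; dec-true; dec-false)
open import Relation.Binary.PropositionalEquality hiding ([_])
open +-*-Solver using (solve; con) renaming (_:+_ to _⊕_; _:*_ to _⊛_; _:-_ to _⊝_; :-_ to ⊖_; _:=_ to _⊜_)

-- By deferred decisions, the random choices amount to sweeping through the vertices in a uniformly random
-- order and recolouring those that are in conflict when met: a recoloured vertex never becomes
-- conflicted again and creates no new conflict. So when v is met, it is conflicted only if its colour
-- occurs among the initial colours of its later neighbours T, and the number of colours free at v
-- is at least 1 + (Δ − deg v) + dup T, where dup counts repetitions in the list of colours. Hence v costs at most
--   (Δ+1) (H (Δ − deg v + dup (v ∷ T)) − H (Δ − deg v + dup T)),   H the harmonic numbers.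
-- The initial colours of v and its neighbours are exchangeable and the position of v among them is
-- uniform, so averaging telescopes this to at most (Δ+1)/(deg v + 1) · (H (Δ+1) − H (Δ − deg v)) ≤ 1 + H (Δ+1).

-- Embedding ℕ in ℚ, and harmonic numbers

-- Opaque, so that conversion checking does not unfold the gcds inside _/_.
opaque
  ι : ℕ → ℚ
  ι n = + n / 1

  recip : ℕ → ℚ
  recip n = + 1 / suc n

  ι≡/1 : ∀ n → ι n ≡ + n / 1
  ι≡/1 n = refl

  recip≡1/suc : ∀ n → recip n ≡ + 1 / suc n
  recip≡1/suc n = refl

  ι-0 : ι 0 ≡ 0ℚ
  ι-0 = refl

  ι-1 : ι 1 ≡ 1ℚ
  ι-1 = refl

  recip-0 : recip 0 ≡ 1ℚ
  recip-0 = refl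

  -- Arithmetic is checked on unnormalised fractions, where sums and products compute without gcds,
  -- and is carried back along `toℚᵘ`.
  toℚᵘ-ι : ∀ n → toℚᵘ (ι n) ℚᵘ.≃ mkℚᵘ (+ n) 0
  toℚᵘ-ι n = ℚ.toℚᵘ-fromℚᵘ (mkℚᵘ (+ n) 0)

  toℚᵘ-recip : ∀ n → toℚᵘ (recip n) ℚᵘ.≃ mkℚᵘ (+ 1) n
  toℚᵘ-recip n = ℚ.toℚᵘ-fromℚᵘ (mkℚᵘ (+ 1) n)

  0≤recip : ∀ n → 0ℚ ≤ recip n
  0≤recip n = ℚ.nonNegative⁻¹ (recip n) {{ℚ.normalize-nonNeg 1 (suc n)}}

infixl 7 _·_
_·_ : ℚ → ℚ → ℚ
_·_ = ℚ._*_

ι-+ : ∀ m n → ι (m ℕ.+ n) ≡ ι m + ι n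
ι-+ m n = ℚ.toℚᵘ-injective (begin
  toℚᵘ (ι (m ℕ.+ n))           ≈⟨ toℚᵘ-ι (m ℕ.+ n) ⟩
  mkℚᵘ (+ (m ℕ.+ n)) 0         ≈⟨ *≡* (cong (Data.Integer._* + 1) (cong₂ Data.Integer._+_ (sym (ℤ.*-identityʳ (+ m))) (sym (ℤ.*-identityʳ (+ n))))) ⟩
  mkℚᵘ (+ m) 0 ℚᵘ.+ mkℚᵘ (+ n) 0 ≈⟨ ℚᵘ.+-cong (ℚᵘ.≃-sym (toℚᵘ-ι m)) (ℚᵘ.≃-sym (toℚᵘ-ι n)) ⟩
  toℚᵘ (ι m) ℚᵘ.+ toℚᵘ (ι n)   ≈⟨ ℚᵘ.≃-sym (ℚ.toℚᵘ-homo-+ (ι m) (ι n)) ⟩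
  toℚᵘ (ι m + ι n)             ∎)
  where open ℚᵘ.≃-Reasoning

ι-* : ∀ m n → ι (m ℕ.* n) ≡ ι m · ι n
ι-* m n = ℚ.toℚᵘ-injective (begin
  toℚᵘ (ι (m ℕ.* n))           ≈⟨ toℚᵘ-ι (m ℕ.* n) ⟩
  mkℚᵘ (+ (m ℕ.* n)) 0         ≈⟨ *≡* (cong (Data.Integer._* + 1) (ℤ.pos-* m n)) ⟩
  mkℚᵘ (+ m) 0 ℚᵘ.* mkℚᵘ (+ n) 0 ≈⟨ ℚᵘ.*-cong (ℚᵘ.≃-sym (toℚᵘ-ι m)) (ℚᵘ.≃-sym (toℚᵘ-ι n)) ⟩
  toℚᵘ (ι m) ℚᵘ.* toℚᵘ (ι n)   ≈⟨ ℚᵘ.≃-sym (ℚ.toℚᵘ-homo-* (ι m) (ι n)) ⟩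
  toℚᵘ (ι m · ι n)             ∎)
  where open ℚᵘ.≃-Reasoning

ι-suc : ∀ n → ι (suc n) ≡ 1ℚ + ι n
ι-suc n = trans (ι-+ 1 n) (cong (λ z → z + ι n) ι-1)

ι-mono : ∀ {m n} → m ℕ.≤ n → ι m ≤ ι n
ι-mono {m} {n} m≤n = ℚ.toℚᵘ-cancel-≤ (begin
  toℚᵘ (ι m)   ≃⟨ toℚᵘ-ι m ⟩
  mkℚᵘ (+ m) 0 ≤⟨ *≤* (ℤ.*-monoʳ-≤-nonNeg (+ 1) (Data.Integer.+≤+ m≤n)) ⟩
  mkℚᵘ (+ n) 0 ≃⟨ ℚᵘ.≃-sym (toℚᵘ-ι n) ⟩
  toℚᵘ (ι n)   ∎)
  where open ℚᵘ.≤-Reasoning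

ι-recip : ∀ n → ι (suc n) · recip n ≡ 1ℚ
ι-recip n = ℚ.toℚᵘ-injective (begin
  toℚᵘ (ι (suc n) · recip n)               ≈⟨ ℚ.toℚᵘ-homo-* (ι (suc n)) (recip n) ⟩
  toℚᵘ (ι (suc n)) ℚᵘ.* toℚᵘ (recip n)     ≈⟨ ℚᵘ.*-cong (toℚᵘ-ι (suc n)) (toℚᵘ-recip n) ⟩
  mkℚᵘ (+ suc n) 0 ℚᵘ.* mkℚᵘ (+ 1) n       ≈⟨ *≡* (cong +_ (trans (ℕ.*-identityʳ _) (trans (ℕ.*-identityʳ (suc n)) (sym (trans (ℕ.*-identityˡ _) (ℕ.*-identityˡ _)))))) ⟩
  mkℚᵘ (+ 1) 0                             ∎)
  where open ℚᵘ.≃-Reasoning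

ι-injective : ∀ {m n} → ι m ≡ ι n → m ≡ n
ι-injective {m} {n} eq with ℚᵘ.≃-trans (ℚᵘ.≃-sym (toℚᵘ-ι m)) (ℚᵘ.≃-trans (ℚ.toℚᵘ-cong eq) (toℚᵘ-ι n))
... | *≡* e = ℤ.+-injective (trans (sym (ℤ.*-identityʳ (+ m))) (trans e (ℤ.*-identityʳ (+ n))))

0≤ι : ∀ n → 0ℚ ≤ ι n
0≤ι n = subst (_≤ ι n) ι-0 (ι-mono ℕ.z≤n)

*-monoˡ : ∀ {p q r} → 0ℚ ≤ r → p ≤ q → r · p ≤ r · q
*-monoˡ {r = r} 0≤r = ℚ.*-monoˡ-≤-nonNeg r {{nonNegative 0≤r}}

*-monoʳ : ∀ {p q r} → 0ℚ ≤ r → p ≤ q → p · r ≤ q · r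
*-monoʳ {r = r} 0≤r = ℚ.*-monoʳ-≤-nonNeg r {{nonNegative 0≤r}}

*-nonNeg : ∀ {p q} → 0ℚ ≤ p → 0ℚ ≤ q → 0ℚ ≤ p · q
*-nonNeg {p} {q} 0≤p 0≤q = ≤-trans (≤-reflexive (sym (ℚ.*-zeroʳ p))) (*-monoˡ 0≤p 0≤q)

+-nonNeg : ∀ {p q} → 0ℚ ≤ p → 0ℚ ≤ q → 0ℚ ≤ p + q
+-nonNeg 0≤p 0≤q = ≤-trans (≤-reflexive (sym (ℚ.+-identityʳ 0ℚ))) (+-mono-≤ 0≤p 0≤q)

recip-ι : ∀ n p → recip n · (ι (suc n) · p) ≡ p
recip-ι n p = begin
  recip n · (ι (suc n) · p) ≡⟨ solve 3 (λ r i q → r ⊛ (i ⊛ q) ⊜ (i ⊛ r) ⊛ q) refl (recip n) (ι (suc n)) p ⟩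
  (ι (suc n) · recip n) · p ≡⟨ cong (_· p) (ι-recip n) ⟩
  1ℚ · p                    ≡⟨ ℚ.*-identityˡ p ⟩
  p                         ∎
  where open ≡-Reasoning

ι-cancel-≤ : ∀ n {p q} → ι (suc n) · p ≤ ι (suc n) · q → p ≤ q
ι-cancel-≤ n {p} {q} le = subst₂ _≤_ (recip-ι n p) (recip-ι n q) (*-monoˡ (0≤recip n) le)

ι-cancel-≡ : ∀ n {p q} → ι (suc n) · p ≡ ι (suc n) · q → p ≡ q
ι-cancel-≡ n {p} {q} eq = subst₂ _≡_ (recip-ι n p) (recip-ι n q) (cong (recip n ·_) eq)

ι*recip≤1 : ∀ {m n} → m ℕ.≤ suc n → ι m · recip n ≤ 1ℚ
ι*recip≤1 {m} {n} m≤ = ≤-trans (*-monoʳ (0≤recip n) (ι-mono m≤)) (≤-reflexive (ι-recip n))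

recip-antitone : ∀ {m n} → m ℕ.≤ n → recip n ≤ recip m
recip-antitone {m} {n} m≤n = ι-cancel-≤ m (≤-trans (ι*recip≤1 (ℕ.s≤s m≤n)) (≤-reflexive (sym (ι-recip m))))

recip-double : ∀ m → recip (suc (m ℕ.+ m)) + recip (suc (m ℕ.+ m)) ≡ recip m
recip-double m = ι-cancel-≡ m (begin
  ι (suc m) · (r + r)           ≡⟨ solve 2 (λ i r → i ⊛ (r ⊕ r) ⊜ (i ⊕ i) ⊛ r) refl (ι (suc m)) r ⟩
  (ι (suc m) + ι (suc m)) · r   ≡⟨ cong (_· r) (sym (ι-+ (suc m) (suc m))) ⟩
  ι (suc m ℕ.+ suc m) · r       ≡⟨ cong (λ k → ι (suc k) · r) (ℕ.+-suc m m) ⟩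
  ι (suc (suc (m ℕ.+ m))) · r   ≡⟨ ι-recip (suc (m ℕ.+ m)) ⟩
  1ℚ                            ≡⟨ sym (ι-recip m) ⟩
  ι (suc m) · recip m           ∎)
  where
  open ≡-Reasoning
  r = recip (suc (m ℕ.+ m))

harmonic : ℕ → ℚ
harmonic zero    = 0ℚ
harmonic (suc n) = harmonic n + recip n

p≤p+q : ∀ {p q} → 0ℚ ≤ q → p ≤ p + q
p≤p+q {p} {q} 0≤q = ≤-trans (≤-reflexive (sym (ℚ.+-identityʳ p))) (ℚ.+-monoʳ-≤ p 0≤q)

harmonic-mono : ∀ {m n} → m ℕ.≤ n → harmonic m ≤ harmonic n
harmonic-mono = go ∘ ℕ.≤⇒≤′
  where
  go : ∀ {m n} → m ℕ.≤′ n → harmonic m ≤ harmonic n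
  go ℕ.≤′-refl                = ≤-refl
  go (ℕ.≤′-step {n = n} m≤n) = ≤-trans (go m≤n) (p≤p+q (0≤recip n))

harmonic-nonNeg : ∀ n → 0ℚ ≤ harmonic n
harmonic-nonNeg n = harmonic-mono {0} {n} ℕ.z≤n

-- Apart from the leading 1, the terms on the left pair up as 1/(2j) and 1/(2j + 1) for j from 1 to
-- m, and each pair is at most 2/(2j) = 1/j.
harmonic-double : ∀ m → harmonic (suc (m ℕ.+ m)) ≤ 1ℚ + harmonic m
harmonic-double zero    = ≤-reflexive (trans (ℚ.+-identityˡ (recip 0)) (trans recip-0 (sym (ℚ.+-identityʳ 1ℚ))))
harmonic-double (suc m) = begin
  harmonic (suc (suc m ℕ.+ suc m))               ≡⟨ cong (λ k → harmonic (suc (suc k))) (ℕ.+-suc m m) ⟩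
  harmonic (suc d) + recip (suc d) + recip (suc (suc d))
    ≤⟨ ℚ.+-monoʳ-≤ (harmonic (suc d) + recip (suc d)) (recip-antitone (ℕ.n≤1+n (suc d))) ⟩
  harmonic (suc d) + recip (suc d) + recip (suc d) ≡⟨ ℚ.+-assoc (harmonic (suc d)) (recip (suc d)) (recip (suc d)) ⟩
  harmonic (suc d) + (recip (suc d) + recip (suc d)) ≡⟨ cong (λ z → harmonic (suc d) + z) (recip-double m) ⟩
  harmonic (suc d) + recip m                     ≤⟨ ℚ.+-monoˡ-≤ (recip m) (harmonic-double m) ⟩
  1ℚ + harmonic m + recip m                      ≡⟨ ℚ.+-assoc 1ℚ (harmonic m) (recip m) ⟩
  1ℚ + harmonic (suc m)                          ∎
  where
  open ≤-Reasoning
  d = m ℕ.+ m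

n≤1+2⌊n/2⌋ : ∀ n → n ℕ.≤ suc (⌊ n /2⌋ ℕ.+ ⌊ n /2⌋)
n≤1+2⌊n/2⌋ zero          = ℕ.z≤n
n≤1+2⌊n/2⌋ (suc zero)    = ℕ.≤-refl
n≤1+2⌊n/2⌋ (suc (suc n)) = ℕ.≤-trans (ℕ.s≤s (ℕ.s≤s (n≤1+2⌊n/2⌋ n))) (ℕ.≤-reflexive (cong (λ k → suc (suc k)) (sym (ℕ.+-suc ⌊ n /2⌋ ⌊ n /2⌋))))

-- As n ≤ 2⌊n/2⌋ + 1, `harmonic-double` charges 1 for each halving of n, and the logarithm drops by
-- 1 with each halving as long as n ≥ 2.
harmonic≤1+log : ∀ n → harmonic n ≤ ι (suc ⌊log₂ n ⌋)
harmonic≤1+log n = go n (ℕ.≤-refl {suc n})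
  where
  open ≤-Reasoning
  -- Halving is not a structural descent, so the recursion runs on `fuel`.
  go : ∀ {fuel} n → n ℕ.< fuel → harmonic n ≤ ι (suc ⌊log₂ n ⌋)
  go zero       _ = 0≤ι 1
  go (suc zero) _ = ≤-reflexive (trans (ℚ.+-identityˡ (recip 0)) (trans recip-0 (sym ι-1)))
  go {suc fuel} n@(suc (suc n′)) (ℕ.s≤s n<) = begin
    harmonic n                             ≤⟨ harmonic-mono (n≤1+2⌊n/2⌋ n) ⟩
    harmonic (suc (⌊ n /2⌋ ℕ.+ ⌊ n /2⌋))   ≤⟨ harmonic-double ⌊ n /2⌋ ⟩
    1ℚ + harmonic ⌊ n /2⌋                  ≤⟨ ℚ.+-monoʳ-≤ 1ℚ (go ⌊ n /2⌋ (ℕ.<-≤-trans (ℕ.⌊n/2⌋<n (suc n′)) n<)) ⟩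
    1ℚ + ι (suc ⌊log₂ ⌊ n /2⌋ ⌋)           ≡⟨ sym (ι-suc (suc ⌊log₂ ⌊ n /2⌋ ⌋)) ⟩
    ι (suc (suc ⌊log₂ ⌊ n /2⌋ ⌋))          ≡⟨ cong (ι ∘ suc) halve ⟩
    ι (suc ⌊log₂ n ⌋)                      ∎
    where
    open import Data.Nat.Logarithm using (⌊log₂⌊n/2⌋⌋≡⌊log₂n⌋∸1; ⌊log₂⌋-mono-≤)
    -- The logarithm of n ≥ 2 is at least 1, so the truncated subtraction of 1 can be undone.
    halve : suc ⌊log₂ ⌊ n /2⌋ ⌋ ≡ ⌊log₂ n ⌋
    halve = trans (cong suc (⌊log₂⌊n/2⌋⌋≡⌊log₂n⌋∸1 n)) (ℕ.m+[n∸m]≡n (⌊log₂⌋-mono-≤ {2} {n} (ℕ.s≤s (ℕ.s≤s ℕ.z≤n))))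

-- Each of the e summands of the difference is at most 1 / a.
harmonic-gap : ∀ a e → ι a · (harmonic (a ℕ.+ e) - harmonic a) ≤ ι e
harmonic-gap a zero    = ≤-reflexive (begin
  ι a · (harmonic (a ℕ.+ 0) - harmonic a) ≡⟨ cong (λ k → ι a · (harmonic k - harmonic a)) (ℕ.+-identityʳ a) ⟩
  ι a · (harmonic a - harmonic a)         ≡⟨ cong (ι a ·_) (ℚ.+-inverseʳ (harmonic a)) ⟩
  ι a · 0ℚ                                ≡⟨ ℚ.*-zeroʳ (ι a) ⟩
  0ℚ                                      ≡⟨ sym ι-0 ⟩
  ι 0                                     ∎)
  where open ≡-Reasoning
harmonic-gap a (suc e) = begin
  ι a · (harmonic (a ℕ.+ suc e) - harmonic a)
    ≡⟨ cong (λ k → ι a · (harmonic k - harmonic a)) (ℕ.+-suc a e) ⟩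
  ι a · (harmonic (a ℕ.+ e) + recip (a ℕ.+ e) - harmonic a)
    ≡⟨ solve 4 (λ i h r g → i ⊛ ((h ⊕ r) ⊝ g) ⊜ i ⊛ r ⊕ i ⊛ (h ⊝ g)) refl (ι a) (harmonic (a ℕ.+ e)) (recip (a ℕ.+ e)) (harmonic a) ⟩
  ι a · recip (a ℕ.+ e) + ι a · (harmonic (a ℕ.+ e) - harmonic a)
    ≤⟨ +-mono-≤ (ι*recip≤1 (ℕ.m≤n⇒m≤1+n (ℕ.m≤m+n a e))) (harmonic-gap a e) ⟩
  1ℚ + ι e      ≡⟨ sym (ι-suc e) ⟩
  ι (suc e)     ∎
  where open ≤-Reasoning

-- Finite sums and averages

private variable
  A B : Set

∑ : List A → (A → ℚ) → ℚ
∑ xs f = sumℚ (map f xs)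

mean : List A → (A → ℚ) → ℚ
mean xs f = avg (map f xs)

∑-cong : ∀ (xs : List A) {f g : A → ℚ} → (∀ x → f x ≡ g x) → ∑ xs f ≡ ∑ xs g
∑-cong xs f≗g = cong sumℚ (List.map-cong f≗g xs)

∑-mono : ∀ (xs : List A) {f g : A → ℚ} → (∀ x → f x ≤ g x) → ∑ xs f ≤ ∑ xs g
∑-mono []       f≤g = ≤-refl
∑-mono (x ∷ xs) f≤g = +-mono-≤ (f≤g x) (∑-mono xs f≤g)

∑-+ : ∀ (xs : List A) (f g : A → ℚ) → ∑ xs (λ x → f x + g x) ≡ ∑ xs f + ∑ xs g
∑-+ []       f g = refl
∑-+ (x ∷ xs) f g = trans (cong (λ z → f x + g x + z) (∑-+ xs f g))
  (solve 4 (λ a b c d → (a ⊕ b) ⊕ (c ⊕ d) ⊜ (a ⊕ c) ⊕ (b ⊕ d)) refl (f x) (g x) (∑ xs f) (∑ xs g))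

∑-*ˡ : ∀ (xs : List A) c (f : A → ℚ) → ∑ xs (λ x → c · f x) ≡ c · ∑ xs f
∑-*ˡ []       c f = sym (ℚ.*-zeroʳ c)
∑-*ˡ (x ∷ xs) c f = trans (cong (λ z → c · f x + z) (∑-*ˡ xs c f)) (sym (ℚ.*-distribˡ-+ c (f x) (∑ xs f)))

∑-*ʳ : ∀ (xs : List A) c (f : A → ℚ) → ∑ xs (λ x → f x · c) ≡ ∑ xs f · c
∑-*ʳ xs c f = trans (∑-cong xs (λ x → ℚ.*-comm (f x) c)) (trans (∑-*ˡ xs c f) (ℚ.*-comm c (∑ xs f)))

∑-const : ∀ (xs : List A) c → ∑ xs (λ _ → c) ≡ ι (length xs) · c
∑-const []       c = sym (trans (cong (_· c) ι-0) (ℚ.*-zeroˡ c))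
∑-const (x ∷ xs) c = begin
  c + ∑ xs (λ _ → c)       ≡⟨ cong₂ _+_ (sym (ℚ.*-identityˡ c)) (∑-const xs c) ⟩
  1ℚ · c + ι (length xs) · c ≡⟨ sym (ℚ.*-distribʳ-+ c 1ℚ (ι (length xs))) ⟩
  (1ℚ + ι (length xs)) · c ≡⟨ cong (_· c) (sym (ι-suc (length xs))) ⟩
  ι (length (x ∷ xs)) · c  ∎
  where open ≡-Reasoning

∑-0 : ∀ (xs : List A) → ∑ xs (λ _ → 0ℚ) ≡ 0ℚ
∑-0 xs = trans (∑-const xs 0ℚ) (ℚ.*-zeroʳ (ι (length xs)))

∑-swap : ∀ (xs : List A) (ys : List B) (f : A → B → ℚ) →
         ∑ xs (λ x → ∑ ys (f x)) ≡ ∑ ys (λ y → ∑ xs (λ x → f x y))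
∑-swap []       ys f = sym (∑-0 ys)
∑-swap (x ∷ xs) ys f = trans (cong (λ z → ∑ ys (f x) + z) (∑-swap xs ys f))
                             (sym (∑-+ ys (f x) (λ y → ∑ xs (λ z → f z y))))

∑-++ : ∀ (xs ys : List A) (f : A → ℚ) → ∑ (xs ++ ys) f ≡ ∑ xs f + ∑ ys f
∑-++ []       ys f = sym (ℚ.+-identityˡ (∑ ys f))
∑-++ (x ∷ xs) ys f = trans (cong (λ z → f x + z) (∑-++ xs ys f)) (sym (ℚ.+-assoc (f x) (∑ xs f) (∑ ys f)))

∑-map : ∀ (h : A → B) (xs : List A) (f : B → ℚ) → ∑ (map h xs) f ≡ ∑ xs (λ x → f (h x))
∑-map h xs f = cong sumℚ (sym (List.map-∘ xs))

∑-concatMap : ∀ (h : A → List B) (xs : List A) (f : B → ℚ) →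
              ∑ (concatMap h xs) f ≡ ∑ xs (λ x → ∑ (h x) f)
∑-concatMap h []       f = refl
∑-concatMap h (x ∷ xs) f = trans (∑-++ (h x) (concatMap h xs) f) (cong (λ z → ∑ (h x) f + z) (∑-concatMap h xs f))

-- The value 0 at 0 matches `avg [] = 0`, so that `mean≡∑` holds for the empty list as well.
inv : ℕ → ℚ
inv zero    = 0ℚ
inv (suc n) = recip n

inv-* : ∀ m n → inv (m ℕ.* n) ≡ inv m · inv n
inv-* zero    n       = sym (ℚ.*-zeroˡ (inv n))
inv-* (suc m) zero    = trans (cong inv (ℕ.*-zeroʳ m)) (sym (ℚ.*-zeroʳ (recip m)))
inv-* (suc m) (suc n) = ι-cancel-≡ (n ℕ.+ m ℕ.* suc n) (begin
  ι (suc m ℕ.* suc n) · recip (n ℕ.+ m ℕ.* suc n)   ≡⟨ ι-recip (n ℕ.+ m ℕ.* suc n) ⟩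
  1ℚ                                                ≡⟨ cong₂ _·_ (sym (ι-recip m)) (sym (ι-recip n)) ⟩
  (ι (suc m) · recip m) · (ι (suc n) · recip n)
    ≡⟨ solve 4 (λ a b c d → (a ⊛ b) ⊛ (c ⊛ d) ⊜ (a ⊛ c) ⊛ (b ⊛ d)) refl (ι (suc m)) (recip m) (ι (suc n)) (recip n) ⟩
  (ι (suc m) · ι (suc n)) · (recip m · recip n)     ≡⟨ cong (_· (recip m · recip n)) (sym (ι-* (suc m) (suc n))) ⟩
  ι (suc m ℕ.* suc n) · (recip m · recip n)         ∎)
  where open ≡-Reasoning

mean≡∑ : ∀ (xs : List A) (f : A → ℚ) → mean xs f ≡ inv (length xs) · ∑ xs f
mean≡∑ []       f = refl
mean≡∑ (x ∷ xs) f = trans (ℚ.*-comm (∑ (x ∷ xs) f) (+ 1 / suc (length (map f xs))))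
  (trans (cong (λ k → (+ 1 / suc k) · ∑ (x ∷ xs) f) (List.length-map f xs))
         (cong (_· ∑ (x ∷ xs) f) (sym (recip≡1/suc (length xs)))))

length*mean : ∀ (xs : List A) (f : A → ℚ) → ι (length xs) · mean xs f ≡ ∑ xs f
length*mean []         f = ℚ.*-zeroʳ (ι 0)
length*mean xs@(_ ∷ ys) f = begin
  ι (length xs) · mean xs f                        ≡⟨ cong (ι (length xs) ·_) (mean≡∑ xs f) ⟩
  ι (length xs) · (recip (length ys) · ∑ xs f)     ≡⟨ sym (ℚ.*-assoc (ι (length xs)) (recip (length ys)) (∑ xs f)) ⟩
  ι (length xs) · recip (length ys) · ∑ xs f       ≡⟨ cong (_· ∑ xs f) (ι-recip (length ys)) ⟩
  1ℚ · ∑ xs f                                      ≡⟨ ℚ.*-identityˡ (∑ xs f) ⟩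
  ∑ xs f                                           ∎
  where open ≡-Reasoning

mean-cong : ∀ (xs : List A) {f g : A → ℚ} → (∀ x → f x ≡ g x) → mean xs f ≡ mean xs g
mean-cong xs f≗g = cong avg (List.map-cong f≗g xs)

0≤inv : ∀ n → 0ℚ ≤ inv n
0≤inv zero    = ≤-refl
0≤inv (suc n) = 0≤recip n

mean-mono : ∀ (xs : List A) {f g : A → ℚ} → (∀ x → f x ≤ g x) → mean xs f ≤ mean xs g
mean-mono xs {f} {g} f≤g = subst₂ _≤_ (sym (mean≡∑ xs f)) (sym (mean≡∑ xs g))
  (*-monoˡ (0≤inv (length xs)) (∑-mono xs f≤g))

mean-+ : ∀ (xs : List A) (f g : A → ℚ) → mean xs (λ x → f x + g x) ≡ mean xs f + mean xs g
mean-+ xs f g = begin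
  mean xs (λ x → f x + g x)          ≡⟨ mean≡∑ xs _ ⟩
  w · ∑ xs (λ x → f x + g x)         ≡⟨ cong (w ·_) (∑-+ xs f g) ⟩
  w · (∑ xs f + ∑ xs g)              ≡⟨ ℚ.*-distribˡ-+ w (∑ xs f) (∑ xs g) ⟩
  w · ∑ xs f + w · ∑ xs g            ≡⟨ cong₂ _+_ (sym (mean≡∑ xs f)) (sym (mean≡∑ xs g)) ⟩
  mean xs f + mean xs g              ∎
  where
  open ≡-Reasoning
  w = inv (length xs)

mean-∑ : ∀ (xs : List A) (ys : List B) (f : A → B → ℚ) →
         mean xs (λ x → ∑ ys (f x)) ≡ ∑ ys (λ y → mean xs (λ x → f x y))
mean-∑ xs ys f = begin
  mean xs (λ x → ∑ ys (f x))            ≡⟨ mean≡∑ xs _ ⟩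
  w · ∑ xs (λ x → ∑ ys (f x))           ≡⟨ cong (w ·_) (∑-swap xs ys f) ⟩
  w · ∑ ys (λ y → ∑ xs (λ x → f x y))   ≡⟨ sym (∑-*ˡ ys w (λ y → ∑ xs (λ x → f x y))) ⟩
  ∑ ys (λ y → w · ∑ xs (λ x → f x y))   ≡⟨ ∑-cong ys (λ y → sym (mean≡∑ xs (λ x → f x y))) ⟩
  ∑ ys (λ y → mean xs (λ x → f x y))    ∎
  where
  open ≡-Reasoning
  w = inv (length xs)

mean-*ˡ : ∀ (xs : List A) c (f : A → ℚ) → mean xs (λ x → c · f x) ≡ c · mean xs f
mean-*ˡ xs c f = begin
  mean xs (λ x → c · f x)     ≡⟨ mean≡∑ xs _ ⟩
  w · ∑ xs (λ x → c · f x)    ≡⟨ cong (w ·_) (∑-*ˡ xs c f) ⟩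
  w · (c · ∑ xs f)            ≡⟨ solve 3 (λ a b s → a ⊛ (b ⊛ s) ⊜ b ⊛ (a ⊛ s)) refl w c (∑ xs f) ⟩
  c · (w · ∑ xs f)            ≡⟨ cong (c ·_) (sym (mean≡∑ xs f)) ⟩
  c · mean xs f               ∎
  where
  open ≡-Reasoning
  w = inv (length xs)

mean-- : ∀ (xs : List A) (f g : A → ℚ) → mean xs (λ x → f x - g x) ≡ mean xs f - mean xs g
mean-- xs f g = begin
  mean xs (λ x → f x - g x)            ≡⟨ mean-cong xs (λ x → cong (λ z → f x + z) (neg≡ (g x))) ⟩
  mean xs (λ x → f x + - 1ℚ · g x)     ≡⟨ mean-+ xs f _ ⟩
  mean xs f + mean xs (λ x → - 1ℚ · g x) ≡⟨ cong (λ z → mean xs f + z) (trans (mean-*ˡ xs (- 1ℚ) g) (sym (neg≡ (mean xs g)))) ⟩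
  mean xs f - mean xs g                ∎
  where
  open ≡-Reasoning
  neg≡ : ∀ p → - p ≡ - 1ℚ · p
  neg≡ p = trans (cong -_ (sym (ℚ.*-identityˡ p))) (ℚ.neg-distribˡ-* 1ℚ p)

mean-swap : ∀ (xs : List A) (ys : List B) (f : A → B → ℚ) →
            mean xs (λ x → mean ys (f x)) ≡ mean ys (λ y → mean xs (λ x → f x y))
mean-swap xs ys f = begin
  mean xs (λ x → mean ys (f x))          ≡⟨ mean-cong xs (λ x → mean≡∑ ys (f x)) ⟩
  mean xs (λ x → w · ∑ ys (f x))         ≡⟨ mean-*ˡ xs w _ ⟩
  w · mean xs (λ x → ∑ ys (f x))         ≡⟨ cong (w ·_) (mean-∑ xs ys f) ⟩
  w · ∑ ys (λ y → mean xs (λ x → f x y)) ≡⟨ sym (mean≡∑ ys _) ⟩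
  mean ys (λ y → mean xs (λ x → f x y))  ∎
  where
  open ≡-Reasoning
  w = inv (length ys)

mean-const : ∀ x (xs : List A) c → mean (x ∷ xs) (λ _ → c) ≡ c
mean-const x xs c = ι-cancel-≡ (length xs) (trans (length*mean (x ∷ xs) (λ _ → c)) (∑-const (x ∷ xs) c))

length-product : ∀ {C : Set} (h : A → B → C) (xs : List A) (ys : List B) →
                 length (concatMap (λ x → map (h x) ys) xs) ≡ length xs ℕ.* length ys
length-product h []       ys = refl
length-product h (x ∷ xs) ys = trans (List.length-++ (map (h x) ys))
  (cong₂ ℕ._+_ (List.length-map (h x) ys) (length-product h xs ys))

-- The blocks `map (h x) ys` all have the same length, so every block gets the same weight in the
-- average over the concatenation. `allFuns` is built in this shape.
mean-product : ∀ {C : Set} (h : A → B → C) (xs : List A) (ys : List B) (f : C → ℚ) →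
               mean (concatMap (λ x → map (h x) ys) xs) f ≡ mean xs (λ x → mean ys (λ y → f (h x y)))
mean-product h xs ys f = begin
  mean zs f                                              ≡⟨ mean≡∑ zs f ⟩
  inv (length zs) · ∑ zs f                               ≡⟨ cong₂ _·_ weight total ⟩
  inv (length xs) · w · ∑ xs (λ x → ∑ ys (λ y → f (h x y)))
    ≡⟨ ℚ.*-assoc (inv (length xs)) w _ ⟩
  inv (length xs) · (w · ∑ xs (λ x → ∑ ys (λ y → f (h x y))))
    ≡⟨ cong (inv (length xs) ·_) (sym (∑-*ˡ xs w _)) ⟩
  inv (length xs) · ∑ xs (λ x → w · ∑ ys (λ y → f (h x y)))
    ≡⟨ cong (inv (length xs) ·_) (∑-cong xs (λ x → sym (mean≡∑ ys (λ y → f (h x y))))) ⟩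
  inv (length xs) · ∑ xs (λ x → mean ys (λ y → f (h x y))) ≡⟨ sym (mean≡∑ xs _) ⟩
  mean xs (λ x → mean ys (λ y → f (h x y)))              ∎
  where
  open ≡-Reasoning
  zs = concatMap (λ x → map (h x) ys) xs
  w = inv (length ys)
  weight : inv (length zs) ≡ inv (length xs) · w
  weight = trans (cong inv (length-product h xs ys)) (inv-* (length xs) (length ys))
  total : ∑ zs f ≡ ∑ xs (λ x → ∑ ys (λ y → f (h x y)))
  total = trans (∑-concatMap (λ x → map (h x) ys) xs f) (∑-cong xs (λ x → ∑-map (h x) ys f))

-- Indicators and subsets of Fin n, given by their characteristic functions

⟦_⟧ : Bool → ℚ
⟦ b ⟧ = if b then 1ℚ else 0ℚ

0≤⟦_⟧ : ∀ b → 0ℚ ≤ ⟦ b ⟧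
0≤⟦ true  ⟧ = subst (0ℚ ≤_) ι-1 (0≤ι 1)
0≤⟦ false ⟧ = ≤-refl

∑-filter : ∀ (P : A → Bool) (xs : List A) (f : A → ℚ) →
           ∑ (filter (λ u → P u Bool.≟ true) xs) f ≡ ∑ xs (λ u → ⟦ P u ⟧ · f u)
∑-filter P []       f = refl
∑-filter P (x ∷ xs) f with P x
... | true  = cong₂ _+_ (sym (ℚ.*-identityˡ (f x))) (∑-filter P xs f)
... | false = trans (∑-filter P xs f) (trans (sym (ℚ.+-identityˡ _)) (cong (λ z → z + ∑ xs (λ u → ⟦ P u ⟧ · f u)) (sym (ℚ.*-zeroˡ (f x)))))

∑-allFin : ∀ n (f : Fin (suc n) → ℚ) → ∑ (allFin (suc n)) f ≡ f zero + ∑ (allFin n) (λ i → f (suc i))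
∑-allFin n f = cong (λ xs → f zero + sumℚ xs) (trans (List.map-tabulate suc f) (sym (List.map-tabulate id (λ i → f (suc i)))))

∑-single : ∀ {n} (v : Fin n) (f : Fin n → ℚ) → ∑ (allFin n) (λ u → ⟦ does (u Fin.≟ v) ⟧ · f u) ≡ f v
∑-single {suc n} zero    f = begin
  ∑ (allFin (suc n)) (λ u → ⟦ does (u Fin.≟ zero) ⟧ · f u) ≡⟨ ∑-allFin n (λ u → ⟦ does (u Fin.≟ zero) ⟧ · f u) ⟩
  1ℚ · f zero + ∑ (allFin n) (λ u → 0ℚ · f (suc u))
    ≡⟨ cong₂ _+_ (ℚ.*-identityˡ (f zero)) (trans (∑-*ˡ (allFin n) 0ℚ (λ u → f (suc u))) (ℚ.*-zeroˡ (∑ (allFin n) (λ u → f (suc u))))) ⟩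
  f zero + 0ℚ                                              ≡⟨ ℚ.+-identityʳ (f zero) ⟩
  f zero                                                   ∎
  where open ≡-Reasoning
∑-single {suc n} (suc v) f = begin
  ∑ (allFin (suc n)) (λ u → ⟦ does (u Fin.≟ suc v) ⟧ · f u) ≡⟨ ∑-allFin n (λ u → ⟦ does (u Fin.≟ suc v) ⟧ · f u) ⟩
  0ℚ · f zero + ∑ (allFin n) (λ u → ⟦ does (u Fin.≟ v) ⟧ · f (suc u))
    ≡⟨ cong₂ _+_ (ℚ.*-zeroˡ (f zero)) (∑-single v (λ u → f (suc u))) ⟩
  0ℚ + f (suc v)                                            ≡⟨ ℚ.+-identityˡ (f (suc v)) ⟩
  f (suc v)                                                 ∎
  where open ≡-Reasoning

sel : ∀ {n} → (Fin n → Bool) → List (Fin n)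
sel {n} P = filter (λ u → P u Bool.≟ true) (allFin n)

size : ∀ {n} → (Fin n → Bool) → ℕ
size P = length (sel P)

-- Cardinalities are compared through sums of indicators in ℚ; `ι-injective` and `ι-cancel` bring
-- the results back to ℕ.
ι-size : ∀ {n} (P : Fin n → Bool) → ι (size P) ≡ ∑ (allFin n) (λ u → ⟦ P u ⟧)
ι-size {n} P = begin
  ι (size P)                              ≡⟨ sym (ℚ.*-identityʳ (ι (size P))) ⟩
  ι (size P) · 1ℚ                         ≡⟨ sym (∑-const (sel P) 1ℚ) ⟩
  ∑ (sel P) (λ _ → 1ℚ)                    ≡⟨ ∑-filter P (allFin n) (λ _ → 1ℚ) ⟩
  ∑ (allFin n) (λ u → ⟦ P u ⟧ · 1ℚ)       ≡⟨ ∑-cong (allFin n) (λ u → ℚ.*-identityʳ ⟦ P u ⟧) ⟩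
  ∑ (allFin n) (λ u → ⟦ P u ⟧)            ∎
  where open ≡-Reasoning

size-cong : ∀ {n} {P Q : Fin n → Bool} → (∀ u → P u ≡ Q u) → size P ≡ size Q
size-cong {n} {P} {Q} P≗Q = ι-injective (trans (ι-size P)
  (trans (∑-cong (allFin n) (λ u → cong ⟦_⟧ (P≗Q u))) (sym (ι-size Q))))

infixl 6 _∖_
_∖_ : ∀ {n} → (Fin n → Bool) → Fin n → Fin n → Bool
(P ∖ v) u = P u ∧ not (does (u Fin.≟ v))

size-∖ : ∀ {n} (P : Fin n → Bool) v → size P ≡ (if P v then suc (size (P ∖ v)) else size (P ∖ v))
size-∖ {n} P v = ι-injective (begin
  ι (size P)                                       ≡⟨ ι-size P ⟩
  ∑ (allFin n) (λ u → ⟦ P u ⟧)                     ≡⟨ ∑-cong (allFin n) (λ u → split (P u) (does (u Fin.≟ v))) ⟩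
  ∑ (allFin n) (λ u → ⟦ does (u Fin.≟ v) ⟧ · ⟦ P u ⟧ + ⟦ (P ∖ v) u ⟧) ≡⟨ ∑-+ (allFin n) _ _ ⟩
  ∑ (allFin n) (λ u → ⟦ does (u Fin.≟ v) ⟧ · ⟦ P u ⟧) + ∑ (allFin n) (λ u → ⟦ (P ∖ v) u ⟧)
    ≡⟨ cong₂ _+_ (∑-single v (λ u → ⟦ P u ⟧)) (sym (ι-size (P ∖ v))) ⟩
  ⟦ P v ⟧ + ι (size (P ∖ v))                       ≡⟨ join (P v) (size (P ∖ v)) ⟩
  ι (if P v then suc (size (P ∖ v)) else size (P ∖ v)) ∎)
  where
  open ≡-Reasoning
  split : ∀ p e → ⟦ p ⟧ ≡ ⟦ e ⟧ · ⟦ p ⟧ + ⟦ p ∧ not e ⟧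
  split true  true  = refl
  split true  false = refl
  split false true  = refl
  split false false = refl
  join : ∀ b k → ⟦ b ⟧ + ι k ≡ ι (if b then suc k else k)
  join true  k = sym (ι-suc k)
  join false k = ℚ.+-identityˡ (ι k)

size-∖-∈ : ∀ {n m} (P : Fin n → Bool) v → P v ≡ true → size P ≡ suc m → size (P ∖ v) ≡ m
size-∖-∈ P v Pv eq = ℕ.suc-injective (trans (sym (trans (size-∖ P v)
  (cong (λ b → if b then suc (size (P ∖ v)) else size (P ∖ v)) Pv))) eq)

ι-cancel : ∀ {m n} → ι m ≤ ι n → m ℕ.≤ n
ι-cancel {m} {n} le with ℚᵘ.≤-respˡ-≃ (toℚᵘ-ι m) (ℚᵘ.≤-respʳ-≃ (toℚᵘ-ι n) (ℚ.toℚᵘ-mono-≤ le))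
... | *≤* e = ℤ.drop‿+≤+ (subst₂ Data.Integer._≤_ (ℤ.*-identityʳ (+ m)) (ℤ.*-identityʳ (+ n)) e)

size-mono : ∀ {n} {P Q : Fin n → Bool} → (∀ u → P u ≡ true → Q u ≡ true) → size P ℕ.≤ size Q
size-mono {n} {P} {Q} P⊆Q = ι-cancel (subst₂ _≤_ (sym (ι-size P)) (sym (ι-size Q))
  (∑-mono (allFin n) (λ u → indicator-mono (P u) (Q u) (P⊆Q u))))
  where
  indicator-mono : ∀ p q → (p ≡ true → q ≡ true) → ⟦ p ⟧ ≤ ⟦ q ⟧
  indicator-mono false q     _ = 0≤⟦ q ⟧
  indicator-mono true  true  _ = ≤-refl
  indicator-mono true  false h with () ← h refl

-- Repetitions in lists of colours

_∈?_ : ∀ {k} (c : Fin k) (cs : List (Fin k)) → Dec (c ∈ cs)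
_∈?_ = DecMembership._∈?_ Fin._≟_

-- An entry counts when it recurs further on, so this is the length minus the number of distinct
-- entries.
dup : ∀ {k} → List (Fin k) → ℕ
dup []       = 0
dup (c ∷ cs) = if does (c ∈? cs) then suc (dup cs) else dup cs

dup≤length : ∀ {k} (cs : List (Fin k)) → dup cs ℕ.≤ length cs
dup≤length []       = ℕ.z≤n
dup≤length (c ∷ cs) with does (c ∈? cs)
... | true  = ℕ.s≤s (dup≤length cs)
... | false = ℕ.m≤n⇒m≤1+n (dup≤length cs)

does⇒ : ∀ {P : Set} (P? : Dec P) → does P? ≡ true → P
does⇒ (yes p) _ = p

distinct : ∀ {k} → List (Fin k) → ℕ
distinct cs = size (λ c → does (c ∈? cs))

distinct-[] : ∀ {k} → distinct {k} [] ℕ.≤ 0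
distinct-[] {k} = ι-cancel (≤-reflexive (trans (ι-size {k} (λ _ → false)) (trans (∑-0 (allFin k)) (sym ι-0))))

distinct-∷ : ∀ {k} c (cs : List (Fin k)) → distinct (c ∷ cs) ℕ.≤ suc (distinct cs)
distinct-∷ c cs = begin
  distinct (c ∷ cs)                ≡⟨ size-∖ P c ⟩
  (if P c then suc (size (P ∖ c)) else size (P ∖ c)) ≤⟨ branch (P c) ⟩
  suc (size (P ∖ c))               ≤⟨ ℕ.s≤s (size-mono tail) ⟩
  suc (distinct cs)                ∎
  where
  open ℕ.≤-Reasoning
  P = λ d → does (d ∈? (c ∷ cs))
  branch : ∀ b {m} → (if b then suc m else m) ℕ.≤ suc m
  branch true  = ℕ.≤-refl
  branch false = ℕ.n≤1+n _
  tail : ∀ d → (P ∖ c) d ≡ true → does (d ∈? cs) ≡ true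
  tail d eq with does (d Fin.≟ c) | does (d ∈? cs)
  tail d eq | false | true = refl
  tail d () | true  | false
  tail d () | false | false
  tail d eq | true  | true = refl

distinct-∷-old : ∀ {k} {c} {cs : List (Fin k)} → c ∈ cs → distinct (c ∷ cs) ℕ.≤ distinct cs
distinct-∷-old {c = c} {cs} c∈cs = size-mono (λ d eq → dec-true (d ∈? cs) (old (does⇒ (d ∈? (c ∷ cs)) eq)))
  where
  old : ∀ {d} → d ∈ c ∷ cs → d ∈ cs
  old (here refl) = c∈cs
  old (there d∈)  = d∈

-- Each element of `xs` pays for at most one unit on the left: if it is selected and its colour
-- recurs among the selected ones after it, it adds a repetition but no new colour; otherwise it
-- adds at most a new colour. Applied to the neighbours of a vertex, this bounds the number of
-- blocked colours.
distinct+dup≤length : ∀ {k} (χ : A → Fin k) (P : A → Bool) xs →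
  distinct (map χ xs) ℕ.+ dup (map χ (filter (λ u → P u Bool.≟ true) xs)) ℕ.≤ length xs
distinct+dup≤length {k = k} χ P [] = ℕ.≤-trans (ℕ.≤-reflexive (ℕ.+-identityʳ _)) (distinct-[] {k})
distinct+dup≤length χ P (x ∷ xs) with P x | distinct+dup≤length χ P xs
... | false | ih = ℕ.≤-trans (ℕ.+-monoˡ-≤ _ (distinct-∷ (χ x) (map χ xs))) (ℕ.s≤s ih)
... | true  | ih with χ x ∈? map χ (filter (λ u → P u Bool.≟ true) xs)
...   | no  _  = ℕ.≤-trans (ℕ.+-monoˡ-≤ _ (distinct-∷ (χ x) (map χ xs))) (ℕ.s≤s ih)
...   | yes x∈ = ℕ.≤-trans (ℕ.≤-reflexive (ℕ.+-suc _ _)) (ℕ.s≤s (ℕ.≤-trans (ℕ.+-monoˡ-≤ _ (distinct-∷-old x∈′)) ih))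
  where
  x∈′ : χ x ∈ map χ xs
  x∈′ with ∈-map⁻ χ x∈
  ... | y , y∈ , eq = subst (_∈ map χ xs) (sym eq) (∈-map⁺ χ (proj₁ (∈-filter⁻ (λ u → P u Bool.≟ true) y∈)))

mean-allFin-const : ∀ k x → mean (allFin (suc k)) (λ _ → x) ≡ x
mean-allFin-const k x = mean-const zero (Data.List.tabulate {n = k} suc) x

-- Uniformly random colourings

-- The functions listed by `allFuns` agree with `c Vector.∷ χ` only pointwise, so functions of
-- colourings are required to respect pointwise equality.
Extensional : ∀ {n k} → ((Fin n → Fin k) → ℚ) → Set
Extensional f = ∀ {χ χ′} → (∀ i → χ i ≡ χ′ i) → f χ ≡ f χ′

mean-allFuns-suc : ∀ {n k} {f : (Fin (suc n) → Fin k) → ℚ} → Extensional f →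
  mean (allFuns (suc n) k) f ≡ mean (allFin k) (λ c → mean (allFuns n k) (λ χ → f (c Vector.∷ χ)))
mean-allFuns-suc {n} {k} {f} ext = trans (mean-product _ (allFin k) (allFuns n k) f)
  (mean-cong (allFin k) (λ c → mean-cong (allFuns n k) (λ χ → ext λ { zero → refl ; (suc i) → refl })))

mean-allFuns-const : ∀ n k x → mean (allFuns n (suc k)) (λ _ → x) ≡ x
mean-allFuns-const zero    k x = mean-const {A = Fin 0 → Fin (suc k)} (λ ()) [] x
mean-allFuns-const (suc n) k x = begin
  mean (allFuns (suc n) (suc k)) (λ _ → x)                          ≡⟨ mean-allFuns-suc {n} {suc k} {λ _ → x} (λ _ → refl) ⟩
  mean (allFin (suc k)) (λ _ → mean (allFuns n (suc k)) (λ _ → x)) ≡⟨ mean-allFin-const k _ ⟩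
  mean (allFuns n (suc k)) (λ _ → x)                                ≡⟨ mean-allFuns-const n k x ⟩
  x                                                                 ∎
  where open ≡-Reasoning

_[_]≔_ : ∀ {n k} → (Fin n → Fin k) → Fin n → Fin k → Fin n → Fin k
χ [ v ]≔ c = Vector.updateAt χ v (λ _ → c)

-- At vertex `zero` the old colour `d` is overwritten, so averaging over it does nothing and the new
-- colour takes its place; any other vertex is reached by recursion under the first colour.
-- Independence and uniformity of the initial colours enter `mean-restrict` in this form.
mean-resample : ∀ {n k} {f : (Fin n → Fin (suc k)) → ℚ} → Extensional f → ∀ v →
  mean (allFuns n (suc k)) f ≡ mean (allFuns n (suc k)) (λ χ → mean (allFin (suc k)) (λ c → f (χ [ v ]≔ c)))
mean-resample {suc n} {k} {f} ext zero = sym (begin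
  mean (allFuns (suc n) (suc k)) (λ χ → mean cs (λ c → f (χ [ zero ]≔ c)))
    ≡⟨ mean-allFuns-suc (λ eq → mean-cong cs (λ c → ext λ { zero → refl ; (suc i) → eq (suc i) })) ⟩
  mean cs (λ d → mean (allFuns n (suc k)) (λ χ → mean cs (λ c → f ((d Vector.∷ χ) [ zero ]≔ c))))
    ≡⟨ mean-cong cs (λ d → mean-cong (allFuns n (suc k)) (λ χ → mean-cong cs (λ c → ext λ { zero → refl ; (suc i) → refl }))) ⟩
  mean cs (λ _ → mean (allFuns n (suc k)) (λ χ → mean cs (λ c → f (c Vector.∷ χ))))
    ≡⟨ mean-allFin-const k _ ⟩
  mean (allFuns n (suc k)) (λ χ → mean cs (λ c → f (c Vector.∷ χ)))
    ≡⟨ mean-swap (allFuns n (suc k)) cs (λ χ c → f (c Vector.∷ χ)) ⟩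
  mean cs (λ c → mean (allFuns n (suc k)) (λ χ → f (c Vector.∷ χ)))
    ≡⟨ sym (mean-allFuns-suc ext) ⟩
  mean (allFuns (suc n) (suc k)) f ∎)
  where
  open ≡-Reasoning
  cs = allFin (suc k)
mean-resample {suc n} {k} {f} ext (suc v) = begin
  mean (allFuns (suc n) (suc k)) f
    ≡⟨ mean-allFuns-suc ext ⟩
  mean cs (λ d → mean (allFuns n (suc k)) (λ χ → f (d Vector.∷ χ)))
    ≡⟨ mean-cong cs (λ d → mean-resample (λ eq → ext λ { zero → refl ; (suc i) → eq i }) v) ⟩
  mean cs (λ d → mean (allFuns n (suc k)) (λ χ → mean cs (λ c → f (d Vector.∷ (χ [ v ]≔ c)))))
    ≡⟨ mean-cong cs (λ d → mean-cong (allFuns n (suc k)) (λ χ → mean-cong cs (λ c → ext λ { zero → refl ; (suc i) → refl }))) ⟩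
  mean cs (λ d → mean (allFuns n (suc k)) (λ χ → mean cs (λ c → f ((d Vector.∷ χ) [ suc v ]≔ c))))
    ≡⟨ sym (mean-allFuns-suc (λ eq → mean-cong cs (λ c → ext (≔-cong (suc v) c eq)))) ⟩
  mean (allFuns (suc n) (suc k)) (λ χ → mean cs (λ c → f (χ [ suc v ]≔ c))) ∎
  where
  open ≡-Reasoning
  cs = allFin (suc k)
  ≔-cong : ∀ {n k} {χ χ′ : Fin n → Fin k} v c → (∀ i → χ i ≡ χ′ i) → ∀ i → (χ [ v ]≔ c) i ≡ (χ′ [ v ]≔ c) i
  ≔-cong zero    c eq zero    = refl
  ≔-cong zero    c eq (suc i) = eq (suc i)
  ≔-cong (suc v) c eq zero    = eq zero
  ≔-cong (suc v) c eq (suc i) = ≔-cong v c (λ i → eq (suc i)) i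

-- The expectation of `g` at a list of `l` independent uniform colours, as an iterated average that
-- mentions no vertices.
meanSeq : ∀ {k} → ℕ → (List (Fin k) → ℚ) → ℚ
meanSeq     zero    g = g []
meanSeq {k} (suc l) g = mean (allFin k) (λ c → meanSeq l (λ cs → g (c ∷ cs)))

meanSeq-≤ : ∀ {k} l {g : List (Fin (suc k)) → ℚ} {b} → (∀ cs → length cs ≡ l → g cs ≤ b) → meanSeq l g ≤ b
meanSeq-≤     zero    g≤b = g≤b [] refl
meanSeq-≤ {k} (suc l) g≤b = ≤-trans
  (mean-mono (allFin (suc k)) (λ c → meanSeq-≤ l (λ cs eq → g≤b (c ∷ cs) (cong suc eq))))
  (≤-reflexive (mean-allFin-const k _))

-- The vertices of `T` are resampled one after the other; as they are distinct, resampling one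
-- leaves the colours of the others alone. The right side depends on `T` only through its length,
-- which is the exchangeability of the initial colours.
mean-restrict : ∀ {n k} {T : List (Fin n)} → Unique T → (g : List (Fin (suc k)) → ℚ) →
  mean (allFuns n (suc k)) (λ χ → g (map χ T)) ≡ meanSeq (length T) g
mean-restrict {n} {k} [] g = mean-allFuns-const n k (g [])
mean-restrict {n} {k} {u ∷ T} (u∉T ∷ T!) g = begin
  mean χs (λ χ → g (map χ (u ∷ T)))
    ≡⟨ mean-resample (λ eq → cong g (List.map-cong eq (u ∷ T))) u ⟩
  mean χs (λ χ → mean cs (λ c → g (map (χ [ u ]≔ c) (u ∷ T))))
    ≡⟨ mean-cong χs (λ χ → mean-cong cs (λ c → cong g (cong₂ _∷_ (updateAt-updates u χ)
         (List.map-cong-local (All.map (λ u≢w → updateAt-minimal _ u χ (u≢w ∘ sym)) u∉T))))) ⟩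
  mean χs (λ χ → mean cs (λ c → g (c ∷ map χ T)))
    ≡⟨ mean-swap χs cs (λ χ c → g (c ∷ map χ T)) ⟩
  mean cs (λ c → mean χs (λ χ → g (c ∷ map χ T)))
    ≡⟨ mean-cong cs (λ c → mean-restrict T! (λ ds → g (c ∷ ds))) ⟩
  meanSeq (length (u ∷ T)) g ∎
  where
  open ≡-Reasoning
  χs = allFuns n (suc k)
  cs = allFin (suc k)

ι-recip-cancel : ∀ m p → ι (suc m) · (recip m · p) ≡ p
ι-recip-cancel m p = trans (solve 3 (λ a b q → a ⊛ (b ⊛ q) ⊜ b ⊛ (a ⊛ q)) refl (ι (suc m)) (recip m) p) (recip-ι m p)

-- The process

≤-max : ∀ {A : Set} (f : A → ℕ) {x xs} → x ∈ xs → f x ℕ.≤ Data.List.foldr ℕ._⊔_ 0 (map f xs)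
≤-max f (here refl) = ℕ.m≤m⊔n (f _) _
≤-max f (there x∈)  = ℕ.≤-trans (≤-max f x∈) (ℕ.m≤n⊔m (f _) _)

∈-sel⁺ : ∀ {n} (P : Fin n → Bool) {u} → P u ≡ true → u ∈ sel P
∈-sel⁺ P Pu = ∈-filter⁺ (λ u → P u Bool.≟ true) (∈-allFin _) Pu

∈-sel⁻ : ∀ {n} (P : Fin n → Bool) {u} → u ∈ sel P → P u ≡ true
∈-sel⁻ {n} P u∈ = proj₂ (∈-filter⁻ (λ u → P u Bool.≟ true) {xs = allFin n} u∈)

sel-unique : ∀ {n} (P : Fin n → Bool) → Unique (sel P)
sel-unique {n} P = Unique.filter⁺ (λ u → P u Bool.≟ true) (Unique.allFin⁺ n)

∧⁻ : ∀ {a b} → a ∧ b ≡ true → a ≡ true × b ≡ true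
∧⁻ {true} {true} _ = refl , refl

T⇒≡ : ∀ {b} → T b → b ≡ true
T⇒≡ {true} _ = refl

≡⇒T : ∀ {b} → b ≡ true → T b
≡⇒T refl = _

dup≤dup-∷ : ∀ {k} c (cs : List (Fin k)) → dup cs ℕ.≤ dup (c ∷ cs)
dup≤dup-∷ c cs with does (c ∈? cs)
... | true  = ℕ.n≤1+n (dup cs)
... | false = ℕ.≤-refl

dup-∷-∈ : ∀ {k} {c} {cs : List (Fin k)} → c ∈ cs → dup (c ∷ cs) ≡ suc (dup cs)
dup-∷-∈ {c = c} {cs} c∈ = cong (λ b → if b then suc (dup cs) else dup cs) (dec-true (c ∈? cs) c∈)

-- To be read for a vertex v removed from a set containing w: `s` says that v is in the set, `a`
-- that it is adjacent to w, `e` that it is w. Every member contributes `x`, except that w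
-- contributes nothing and the neighbours of w contribute `y`; the hypothesis puts w in the set and
-- not among its own neighbours.
indicator-split : ∀ s a e x y → (e ≡ true → s ≡ true × a ≡ false) →
  ⟦ s ⟧ · (⟦ not e ⟧ · (if a ∧ s then y else x)) ≡ ⟦ s ⟧ · x + ⟦ e ⟧ · - x + ⟦ a ∧ s ⟧ · (y - x)
indicator-split true  true  true  x y h with () ← proj₂ (h refl)
indicator-split true  true  false x y _ = solve 2 (λ x y → con 1ℚ ⊛ (con 1ℚ ⊛ y) ⊜ con 1ℚ ⊛ x ⊕ con 0ℚ ⊛ (⊖ x) ⊕ con 1ℚ ⊛ (y ⊝ x)) refl x y
indicator-split true  false true  x y _ = solve 2 (λ x y → con 1ℚ ⊛ (con 0ℚ ⊛ x) ⊜ con 1ℚ ⊛ x ⊕ con 1ℚ ⊛ (⊖ x) ⊕ con 0ℚ ⊛ (y ⊝ x)) refl x y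
indicator-split true  false false x y _ = solve 2 (λ x y → con 1ℚ ⊛ (con 1ℚ ⊛ x) ⊜ con 1ℚ ⊛ x ⊕ con 0ℚ ⊛ (⊖ x) ⊕ con 0ℚ ⊛ (y ⊝ x)) refl x y
indicator-split false true  true  x y h with () ← proj₂ (h refl)
indicator-split false true  false x y _ = solve 2 (λ x y → con 0ℚ ⊛ (con 1ℚ ⊛ x) ⊜ con 0ℚ ⊛ x ⊕ con 0ℚ ⊛ (⊖ x) ⊕ con 0ℚ ⊛ (y ⊝ x)) refl x y
indicator-split false false true  x y h with () ← proj₁ (h refl)
indicator-split false false false x y _ = solve 2 (λ x y → con 0ℚ ⊛ (con 1ℚ ⊛ x) ⊜ con 0ℚ ⊛ x ⊕ con 0ℚ ⊛ (⊖ x) ⊕ con 0ℚ ⊛ (y ⊝ x)) refl x y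

module _ {n : ℕ} (G : Graph n) where

  private
    Δ K : ℕ
    Δ = maxDegree G
    K = suc Δ

  -- Costs in a sweep

  degree≤Δ : ∀ v → degree G v ℕ.≤ Δ
  degree≤Δ v = ≤-max (degree G) (∈-allFin v)

  -- One less than the number of colours certain to be free at `v`, since there are Δ + 1 colours.
  slack : Fin n → ℕ
  slack v = Δ ℕ.∸ degree G v

  -- `S` stands for the vertices that a sweep has still to meet when it draws `v`.
  later : Fin n → (Fin n → Bool) → List (Fin n)
  later v S = sel (λ u → adj G v u ∧ S u)

  -- Prepending a colour that already occurs in `cs` raises this by 1 / (1 + slack + dup cs), the
  -- reciprocal of the lower bound on the number of free colours. Costs thereby become differences,
  -- which telescope on average.
  potential : Fin n → List (Fin K) → ℚ
  potential v cs = harmonic (slack v ℕ.+ dup cs)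

  cost : Fin n → List (Fin n) → Coloring G → ℚ
  cost v T χ = ι K · (potential v (map χ (v ∷ T)) - potential v (map χ T))

  -- Expected total cost of a sweep through the m-element set S in uniformly random order. It depends on χ
  -- only through its restriction to S, hence is unaffected by recolouring vertices already met.
  sweepCost : ℕ → (Fin n → Bool) → Coloring G → ℚ
  sweepCost zero    S χ = 0ℚ
  sweepCost (suc m) S χ =
    recip m · ∑ (allFin n) (λ v → ⟦ S v ⟧ · (cost v (later v S) χ + sweepCost m (S ∖ v) χ))

  sweepCost-cong : ∀ m S {χ χ′} → (∀ u → S u ≡ true → χ u ≡ χ′ u) → sweepCost m S χ ≡ sweepCost m S χ′
  sweepCost-cong zero    S eq = refl
  sweepCost-cong (suc m) S {χ} {χ′} eq = cong (recip m ·_) (∑-cong (allFin n) term)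
    where
    map-later : ∀ v → map χ (later v S) ≡ map χ′ (later v S)
    map-later v = List.map-cong-local (All.tabulate (λ u∈ → eq _ (proj₂ (∧⁻ (∈-sel⁻ _ u∈)))))
    cost-cong : ∀ v {c c′ : Fin K} {cs cs′} → c ≡ c′ → cs ≡ cs′ →
      ι K · (potential v (c ∷ cs) - potential v cs) ≡ ι K · (potential v (c′ ∷ cs′) - potential v cs′)
    cost-cong v refl refl = refl
    term : ∀ v → ⟦ S v ⟧ · (cost v (later v S) χ + sweepCost m (S ∖ v) χ)
               ≡ ⟦ S v ⟧ · (cost v (later v S) χ′ + sweepCost m (S ∖ v) χ′)
    term v = agree (S v) refl
      where
      x  = cost v (later v S) χ + sweepCost m (S ∖ v) χ
      x′ = cost v (later v S) χ′ + sweepCost m (S ∖ v) χ′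
      agree : ∀ s → S v ≡ s → ⟦ s ⟧ · x ≡ ⟦ s ⟧ · x′
      agree false _  = trans (ℚ.*-zeroˡ x) (sym (ℚ.*-zeroˡ x′))
      agree true  Sv = cong (1ℚ ·_) (cong₂ _+_ (cost-cong v (eq v Sv) (map-later v))
        (sweepCost-cong m (S ∖ v) (λ u u∈ → eq u (proj₁ (∧⁻ u∈)))))

  cost-nonNeg : ∀ v T χ → 0ℚ ≤ cost v T χ
  cost-nonNeg v T χ = *-nonNeg (0≤ι K) (≤-trans (≤-reflexive (sym (ℚ.+-inverseʳ low)))
    (ℚ.+-monoˡ-≤ (- low) (harmonic-mono (ℕ.+-monoʳ-≤ (slack v) (dup≤dup-∷ (χ v) (map χ T))))))
    where low = potential v (map χ T)

  -- One more repetition adds a single harmonic term, so for a conflicted vertex the cost is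
  -- precisely the waiting time allowed by `inner≤`.
  cost-∈ : ∀ v T χ → χ v ∈ map χ T → cost v T χ ≡ ι K · recip (slack v ℕ.+ dup (map χ T))
  cost-∈ v T χ χv∈ = cong (ι K ·_) (begin
    harmonic (slack v ℕ.+ dup (χ v ∷ map χ T)) - low  ≡⟨ cong (λ k → harmonic (slack v ℕ.+ k) - low) (dup-∷-∈ χv∈) ⟩
    harmonic (slack v ℕ.+ suc (dup (map χ T))) - low  ≡⟨ cong (λ k → harmonic k - low) (ℕ.+-suc (slack v) _) ⟩
    low + r - low                                     ≡⟨ solve 2 (λ a b → (a ⊕ b) ⊝ a ⊜ b) refl low r ⟩
    r                                                 ∎)
    where
    open ≡-Reasoning
    low = potential v (map χ T)
    r = recip (slack v ℕ.+ dup (map χ T))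

  sweepCost-nonNeg : ∀ m S χ → 0ℚ ≤ sweepCost m S χ
  sweepCost-nonNeg zero    S χ = ≤-refl
  sweepCost-nonNeg (suc m) S χ = *-nonNeg (0≤recip m)
    (≤-trans (≤-reflexive (sym (∑-0 (allFin n)))) (∑-mono (allFin n) (λ v →
      *-nonNeg 0≤⟦ S v ⟧ (+-nonNeg (cost-nonNeg v (later v S) χ) (sweepCost-nonNeg m (S ∖ v) χ)))))

  -- Comparison of the process with the sweep

  conflicted⁻ : ∀ χ v → conflicted G χ v ≡ true → ∃ λ u → adj G v u ≡ true × χ u ≡ χ v
  conflicted⁻ χ v eq with find (any⁻ _ (allFin n) (≡⇒T eq))
  ... | u , _ , t with adj G v u in a | χ u Fin.≟ χ v
  ...   | true | yes χu≡χv = u , a , χu≡χv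

  conflicted⁺ : ∀ χ v {u} → adj G v u ≡ true → χ u ≡ χ v → conflicted G χ v ≡ true
  conflicted⁺ χ v {u} a χu≡χv = T⇒≡ (any⁺ _ (lose (∈-allFin u) holds))
    where
    holds : T (adj G v u ∧ ⌊ χ u Fin.≟ χ v ⌋)
    holds rewrite a with χ u Fin.≟ χ v
    ... | yes _  = _
    ... | no neq = ⊥-elim (neq χu≡χv)

  update-self : ∀ χ v c → update G χ v c v ≡ c
  update-self χ v c with v Fin.≟ v
  ... | yes _  = refl
  ... | no v≢v = ⊥-elim (v≢v refl)

  update-other : ∀ χ v c {u} → u ≢ v → update G χ v c u ≡ χ u
  update-other χ v c {u} u≢v with u Fin.≟ v
  ... | yes u≡v = ⊥-elim (u≢v u≡v)
  ... | no _    = refl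

  adj⇒≢ : ∀ {u v} → adj G v u ≡ true → u ≢ v
  adj⇒≢ {u} a refl with () ← trans (sym a) (adj-irrefl G u)

  -- The geometric waiting time: a new colour is free with probability at least 1 / (K r).
  inner≤ : ∀ χ₀ v S b → 0ℚ ≤ b →
    (∀ k χ → (∀ u → u ≢ v → χ u ≡ χ₀ u) → conflicted G χ v ≡ false → outer G k χ ≤ b) →
    ∀ k χ → (∀ u → u ≢ v → χ u ≡ χ₀ u) →
    inner G k χ v ≤ ι K · recip (slack v ℕ.+ dup (map χ₀ (later v S))) + b
  inner≤ χ₀ v S b 0≤b outer≤b = go
    where
    open ≤-Reasoning
    free = slack v ℕ.+ dup (map χ₀ (later v S))
    r = recip free
    X = ι K · r
    0≤X : 0ℚ ≤ X
    0≤X = *-nonNeg (0≤ι K) (0≤recip free)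
    nbrs = sel (adj G v)
    taken : Fin K → Bool
    taken c = does (c ∈? map χ₀ nbrs)

    -- Blocked colours and repetitions among later neighbours together number at most deg v, and
    -- `slack v` fills deg v up to Δ. The remaining 1 is the extra colour in K = Δ + 1.
    taken+free≤K : size taken ℕ.+ suc free ℕ.≤ K
    taken+free≤K = ℕ.≤-trans (ℕ.≤-reflexive (ℕ.+-suc _ free)) (ℕ.s≤s (ℕ.≤-trans (ℕ.≤-reflexive rearrange)
      (ℕ.≤-trans (ℕ.+-monoʳ-≤ (slack v) count) (ℕ.≤-reflexive (ℕ.m∸n+n≡m (degree≤Δ v))))))
      where
      rearrange : size taken ℕ.+ free ≡ slack v ℕ.+ (size taken ℕ.+ dup (map χ₀ (later v S)))
      rearrange = trans (sym (ℕ.+-assoc (size taken) (slack v) _))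
        (trans (cong (ℕ._+ dup (map χ₀ (later v S))) (ℕ.+-comm (size taken) (slack v))) (ℕ.+-assoc (slack v) _ _))
      later≡ : later v S ≡ filter (λ u → S u Bool.≟ true) nbrs
      later≡ = filter-∧ (allFin n)
        where
        filter-∧ : ∀ us → filter (λ u → adj G v u ∧ S u Bool.≟ true) us
                        ≡ filter (λ u → S u Bool.≟ true) (filter (λ u → adj G v u Bool.≟ true) us)
        filter-∧ []       = refl
        filter-∧ (u ∷ us) with adj G v u
        ... | false = filter-∧ us
        ... | true with S u
        ...   | false = filter-∧ us
        ...   | true  = cong (u ∷_) (filter-∧ us)
      count : size taken ℕ.+ dup (map χ₀ (later v S)) ℕ.≤ degree G v
      count = subst (λ T → size taken ℕ.+ dup (map χ₀ T) ℕ.≤ degree G v) (sym later≡) (distinct+dup≤length χ₀ S nbrs)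

    mean-taken : mean (allFin K) (λ c → ⟦ taken c ⟧ · X + b) ≡ ι (size taken) · r + b
    mean-taken = ≡.begin
      mean (allFin K) (λ c → ⟦ taken c ⟧ · X + b)  ≡.≡⟨ mean-+ (allFin K) (λ c → ⟦ taken c ⟧ · X) (λ _ → b) ⟩
      mean (allFin K) (λ c → ⟦ taken c ⟧ · X) + mean (allFin K) (λ _ → b)
        ≡.≡⟨ cong₂ _+_ (ι-cancel-≡ Δ scaled) (mean-allFin-const Δ b) ⟩
      ι (size taken) · r + b ≡.∎
      where
      module ≡ = ≡-Reasoning
      scaled : ι K · mean (allFin K) (λ c → ⟦ taken c ⟧ · X) ≡ ι K · (ι (size taken) · r)
      scaled = ≡.begin
        ι K · mean (allFin K) (λ c → ⟦ taken c ⟧ · X)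
          ≡.≡⟨ cong (λ k → ι k · mean (allFin K) (λ c → ⟦ taken c ⟧ · X)) (sym (List.length-tabulate {n = K} id)) ⟩
        ι (length (allFin K)) · mean (allFin K) (λ c → ⟦ taken c ⟧ · X)
          ≡.≡⟨ length*mean (allFin K) (λ c → ⟦ taken c ⟧ · X) ⟩
        ∑ (allFin K) (λ c → ⟦ taken c ⟧ · X)   ≡.≡⟨ ∑-*ʳ (allFin K) X (λ c → ⟦ taken c ⟧) ⟩
        ∑ (allFin K) (λ c → ⟦ taken c ⟧) · X   ≡.≡⟨ cong (_· X) (sym (ι-size taken)) ⟩
        ι (size taken) · (ι K · r)
          ≡.≡⟨ solve 3 (λ s k q → s ⊛ (k ⊛ q) ⊜ k ⊛ (s ⊛ q)) refl (ι (size taken)) (ι K) r ⟩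
        ι K · (ι (size taken) · r) ≡.∎

    go : ∀ k χ → (∀ u → u ≢ v → χ u ≡ χ₀ u) → inner G k χ v ≤ X + b
    go zero    χ agree = +-nonNeg 0≤X 0≤b
    -- X satisfies 1 + (taken / K) X ≤ X: with X = K r and 1 = (1 + free) r, the left side is (taken
    -- + 1 + free) r, and `taken+free≤K` applies.
    go (suc k) χ agree = begin
      inner G (suc k) χ v                                      ≤⟨ ℚ.+-monoʳ-≤ 1ℚ (mean-mono (allFin K) next≤) ⟩
      1ℚ + mean (allFin K) (λ c → ⟦ taken c ⟧ · X + b)         ≡⟨ cong (λ z → 1ℚ + z) mean-taken ⟩
      1ℚ + (ι (size taken) · r + b)                            ≡⟨ cong (λ z → z + (ι (size taken) · r + b)) (sym (ι-recip free)) ⟩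
      ι (suc free) · r + (ι (size taken) · r + b)
        ≡⟨ solve 4 (λ f q t c → f ⊛ q ⊕ (t ⊛ q ⊕ c) ⊜ (t ⊕ f) ⊛ q ⊕ c) refl (ι (suc free)) r (ι (size taken)) b ⟩
      (ι (size taken) + ι (suc free)) · r + b                  ≡⟨ cong (λ z → z · r + b) (sym (ι-+ (size taken) (suc free))) ⟩
      ι (size taken ℕ.+ suc free) · r + b                      ≤⟨ ℚ.+-monoˡ-≤ b (*-monoʳ (0≤recip free) (ι-mono taken+free≤K)) ⟩
      X + b                                                    ∎
      where
      next≤ : ∀ c → (if conflicted G (update G χ v c) v then inner G k (update G χ v c) v else outer G k (update G χ v c))
                  ≤ ⟦ taken c ⟧ · X + b
      next≤ c = bound (conflicted G χ′ v) refl
        where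
        χ′ = update G χ v c
        agree′ : ∀ u → u ≢ v → χ′ u ≡ χ₀ u
        agree′ u u≢v = trans (update-other χ v c u≢v) (agree u u≢v)
        -- Only `v` has changed since `χ₀`, so a colour that leaves `v` in conflict is one that some
        -- neighbour has under `χ₀`.
        is-taken : conflicted G χ′ v ≡ true → taken c ≡ true
        is-taken eq with conflicted⁻ χ′ v eq
        ... | u , a , χ′u≡χ′v = dec-true (c ∈? map χ₀ nbrs) (subst (_∈ map χ₀ nbrs)
          (trans (sym (agree′ u (adj⇒≢ a))) (trans χ′u≡χ′v (update-self χ v c))) (∈-map⁺ χ₀ (∈-sel⁺ (adj G v) a)))
        bound : ∀ q → conflicted G χ′ v ≡ q → (if q then inner G k χ′ v else outer G k χ′) ≤ ⟦ taken c ⟧ · X + b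
        bound true  eq = begin
          inner G k χ′ v         ≤⟨ go k χ′ agree′ ⟩
          X + b                  ≡⟨ cong (λ z → z + b) (sym (ℚ.*-identityˡ X)) ⟩
          1ℚ · X + b             ≡⟨ cong (λ q → ⟦ q ⟧ · X + b) (sym (is-taken eq)) ⟩
          ⟦ taken c ⟧ · X + b    ∎
        bound false eq = begin
          outer G k χ′           ≤⟨ outer≤b k χ′ agree′ eq ⟩
          b                      ≡⟨ sym (ℚ.+-identityˡ b) ⟩
          0ℚ + b                 ≤⟨ ℚ.+-monoˡ-≤ b (*-nonNeg 0≤⟦ taken c ⟧ 0≤X) ⟩
          ⟦ taken c ⟧ · X + b    ∎

  -- Drawing a uniform conflicted vertex amounts to drawing uniformly from a superset `S` and
  -- discarding unconflicted vertices. So |S| copies of the left side split into the sum of `inner`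
  -- over conflicted vertices and one copy for every other member v, and the induction hypothesis
  -- for `S ∖ v` bounds what follows in both cases.
  outer≤sweepCost : ∀ m k S χ → size S ≡ m → (∀ u → conflicted G χ u ≡ true → S u ≡ true) →
                    outer G k χ ≤ sweepCost m S χ
  -- No vertex is conflicted here, and `outer` is the average of an empty list, which is 0.
  outer≤sweepCost zero k S χ |S|≡0 C⊆S = ≤-reflexive (begin
    outer G k χ                                 ≡⟨ mean≡∑ (sel C) (inner G k χ) ⟩
    inv (size C) · ∑ (sel C) (inner G k χ)      ≡⟨ cong (λ s → inv s · ∑ (sel C) (inner G k χ)) none ⟩
    0ℚ · ∑ (sel C) (inner G k χ)                ≡⟨ ℚ.*-zeroˡ (∑ (sel C) (inner G k χ)) ⟩
    0ℚ                                          ∎)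
    where
    open ≡-Reasoning
    C = conflicted G χ
    none : size C ≡ 0
    none = ℕ.n≤0⇒n≡0 (ℕ.≤-trans (size-mono C⊆S) (ℕ.≤-reflexive |S|≡0))
  outer≤sweepCost (suc m) k S χ |S|≡1+m C⊆S = ι-cancel-≤ m (begin
    ι (suc m) · f                                     ≡⟨ cong (λ s → ι s · f) (sym |S|≡1+m) ⟩
    ι (size S) · f                                    ≡⟨ cong (_· f) (ι-size S) ⟩
    ∑ (allFin n) (λ v → ⟦ S v ⟧) · f                  ≡⟨ sym (∑-*ʳ (allFin n) f (λ v → ⟦ S v ⟧)) ⟩
    ∑ (allFin n) (λ v → ⟦ S v ⟧ · f)                  ≡⟨ ∑-cong (allFin n) (λ v → split (C v) (S v) (C⊆S v)) ⟩
    ∑ (allFin n) (λ v → ⟦ C v ⟧ · f + ⟦ S v ∧ not (C v) ⟧ · f) ≡⟨ ∑-+ (allFin n) (λ v → ⟦ C v ⟧ · f) (λ v → ⟦ S v ∧ not (C v) ⟧ · f) ⟩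
    ∑ (allFin n) (λ v → ⟦ C v ⟧ · f) + rest           ≡⟨ cong (λ z → z + rest) conflicted-part ⟩
    ∑ (allFin n) (λ v → ⟦ C v ⟧ · inner G k χ v) + rest
      ≡⟨ sym (∑-+ (allFin n) (λ v → ⟦ C v ⟧ · inner G k χ v) (λ v → ⟦ S v ∧ not (C v) ⟧ · f)) ⟩
    ∑ (allFin n) (λ v → ⟦ C v ⟧ · inner G k χ v + ⟦ S v ∧ not (C v) ⟧ · f) ≤⟨ ∑-mono (allFin n) term≤ ⟩
    ∑ (allFin n) (λ v → ⟦ S v ⟧ · (cost v (later v S) χ + sweepCost m (S ∖ v) χ)) ≡⟨ sym (ι-recip-cancel m _) ⟩
    ι (suc m) · sweepCost (suc m) S χ                 ∎)
    where
    open ≤-Reasoning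
    C = conflicted G χ
    f = outer G k χ
    rest = ∑ (allFin n) (λ v → ⟦ S v ∧ not (C v) ⟧ · f)

    split : ∀ c s → (c ≡ true → s ≡ true) → ⟦ s ⟧ · f ≡ ⟦ c ⟧ · f + ⟦ s ∧ not c ⟧ · f
    split true  true  _ = solve 1 (λ x → con 1ℚ ⊛ x ⊜ con 1ℚ ⊛ x ⊕ con 0ℚ ⊛ x) refl f
    split true  false h with () ← h refl
    split false true  _ = solve 1 (λ x → con 1ℚ ⊛ x ⊜ con 0ℚ ⊛ x ⊕ con 1ℚ ⊛ x) refl f
    split false false _ = solve 1 (λ x → con 0ℚ ⊛ x ⊜ con 0ℚ ⊛ x ⊕ con 0ℚ ⊛ x) refl f

    -- `f` is the average of `inner` over the conflicted vertices; without such vertices both sides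
    -- vanish.
    conflicted-part : ∑ (allFin n) (λ v → ⟦ C v ⟧ · f) ≡ ∑ (allFin n) (λ v → ⟦ C v ⟧ · inner G k χ v)
    conflicted-part = ≡.begin
      ∑ (allFin n) (λ v → ⟦ C v ⟧ · f)               ≡.≡⟨ ∑-*ʳ (allFin n) f (λ v → ⟦ C v ⟧) ⟩
      ∑ (allFin n) (λ v → ⟦ C v ⟧) · f               ≡.≡⟨ cong (_· f) (sym (ι-size C)) ⟩
      ι (size C) · f                                 ≡.≡⟨ length*mean (sel C) (inner G k χ) ⟩
      ∑ (sel C) (inner G k χ)                        ≡.≡⟨ ∑-filter C (allFin n) (inner G k χ) ⟩
      ∑ (allFin n) (λ v → ⟦ C v ⟧ · inner G k χ v)   ≡.∎
      where module ≡ = ≡-Reasoning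

    -- Recolouring v until it is free of conflicts creates no conflict elsewhere.
    still⊆ : ∀ v χ′ → (∀ u → u ≢ v → χ′ u ≡ χ u) → conflicted G χ′ v ≡ false →
             ∀ u → conflicted G χ′ u ≡ true → (S ∖ v) u ≡ true
    still⊆ v χ′ agree v-free u u-conf with conflicted⁻ χ′ u u-conf
    ... | w , a , χ′w≡χ′u = cong₂ (λ p q → p ∧ not q)
        (C⊆S u (conflicted⁺ χ u a (trans (sym (agree w w≢v)) (trans χ′w≡χ′u (agree u u≢v)))))
        (dec-false (u Fin.≟ v) u≢v)
      where
      u≢v : u ≢ v
      u≢v refl with () ← trans (sym u-conf) v-free
      w≢v : w ≢ v
      w≢v refl with () ← trans (sym (conflicted⁺ χ′ v (trans (adj-sym G v u) a) (sym χ′w≡χ′u))) v-free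

    -- The induction hypothesis speaks of `χ′`, which differs from `χ` at most at `v`, outside
    -- `S ∖ v`. The sweep cost may thus be read at the old colouring, and the new colour of `v` has
    -- no influence on it.
    outer-after : ∀ v → S v ≡ true → ∀ k χ′ → (∀ u → u ≢ v → χ′ u ≡ χ u) → conflicted G χ′ v ≡ false →
                  outer G k χ′ ≤ sweepCost m (S ∖ v) χ
    outer-after v Sv k χ′ agree v-free = ≤-trans
      (outer≤sweepCost m k (S ∖ v) χ′ (size-∖-∈ S v Sv |S|≡1+m) (still⊆ v χ′ agree v-free))
      (≤-reflexive (sweepCost-cong m (S ∖ v) (λ u u∈ → agree u (∖⇒≢ u u∈))))
      where
      ∖⇒≢ : ∀ u → (S ∖ v) u ≡ true → u ≢ v
      ∖⇒≢ u u∈ u≡v with () ← trans (sym (proj₂ (∧⁻ {S u} u∈))) (cong not (dec-true (u Fin.≟ v) u≡v))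

    -- By symmetry the neighbour that causes the conflict is conflicted too, hence still lies in
    -- `S`.
    colour∈later : ∀ v → C v ≡ true → χ v ∈ map χ (later v S)
    colour∈later v Cv with conflicted⁻ χ v Cv
    ... | w , a , χw≡χv = subst (_∈ map χ (later v S)) χw≡χv (∈-map⁺ χ (∈-sel⁺ _ (cong₂ _∧_ a
      (C⊆S w (conflicted⁺ χ w (trans (adj-sym G w v) a) (sym χw≡χv))))))

    term≤ : ∀ v → ⟦ C v ⟧ · inner G k χ v + ⟦ S v ∧ not (C v) ⟧ · f
                ≤ ⟦ S v ⟧ · (cost v (later v S) χ + sweepCost m (S ∖ v) χ)
    term≤ v = bound (C v) (S v) refl refl
      where
      r = sweepCost m (S ∖ v) χ
      bound : ∀ c s → C v ≡ c → S v ≡ s →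
              ⟦ c ⟧ · inner G k χ v + ⟦ s ∧ not c ⟧ · f ≤ ⟦ s ⟧ · (cost v (later v S) χ + r)
      bound true  false Cv Sv with () ← trans (sym (C⊆S v Cv)) Sv
      bound false false Cv Sv = ≤-reflexive (solve 3 (λ i x y → con 0ℚ ⊛ i ⊕ con 0ℚ ⊛ x ⊜ con 0ℚ ⊛ y) refl
        (inner G k χ v) f (cost v (later v S) χ + r))
      bound true  true  Cv Sv = begin
        1ℚ · inner G k χ v + 0ℚ · f
          ≡⟨ solve 2 (λ i x → con 1ℚ ⊛ i ⊕ con 0ℚ ⊛ x ⊜ i) refl (inner G k χ v) f ⟩
        inner G k χ v
          ≤⟨ inner≤ χ v S r (sweepCost-nonNeg m (S ∖ v) χ) (outer-after v Sv) k χ (λ _ _ → refl) ⟩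
        ι K · recip (slack v ℕ.+ dup (map χ (later v S))) + r
          ≡⟨ cong (λ z → z + r) (sym (cost-∈ v (later v S) χ (colour∈later v Cv))) ⟩
        cost v (later v S) χ + r        ≡⟨ sym (ℚ.*-identityˡ _) ⟩
        1ℚ · (cost v (later v S) χ + r) ∎
      bound false true  Cv Sv = begin
        0ℚ · inner G k χ v + 1ℚ · f
          ≡⟨ solve 2 (λ i x → con 0ℚ ⊛ i ⊕ con 1ℚ ⊛ x ⊜ x) refl (inner G k χ v) f ⟩
        f                               ≤⟨ outer-after v Sv k χ (λ _ _ → refl) Cv ⟩
        r                               ≡⟨ sym (ℚ.+-identityˡ r) ⟩
        0ℚ + r                          ≤⟨ ℚ.+-monoˡ-≤ r (cost-nonNeg v (later v S) χ) ⟩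
        cost v (later v S) χ + r        ≡⟨ sym (ℚ.*-identityˡ _) ⟩
        1ℚ · (cost v (later v S) χ + r) ∎

  -- Averaging over the initial colouring

  expectedPotential : Fin n → ℕ → ℚ
  expectedPotential v l = meanSeq l (potential v)

  -- Normalised to vanish at 0, so that the increments for j = 0, ..., l add up to `gain v (suc l)`.
  gain : Fin n → ℕ → ℚ
  gain v l = ι K · (expectedPotential v l - expectedPotential v 0)

  -- Expected cost of v in a sweep when l of its neighbours are in the set: the average of
  -- gain v (j + 1) − gain v j over the number j ≤ l of neighbours that come later.
  share : Fin n → ℕ → ℚ
  share v l = recip l · gain v (suc l)

  gain-0 : ∀ v → gain v 0 ≡ 0ℚ
  gain-0 v = trans (cong (ι K ·_) (ℚ.+-inverseʳ (expectedPotential v 0))) (ℚ.*-zeroʳ (ι K))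

  -- For l = 0 the value of `share` is irrelevant: the factor is 0 and so is `gain v 0`.
  share-pred : ∀ v l → ι l · share v (ℕ.pred l) ≡ gain v l
  share-pred v zero    = trans (cong (_· share v 0) ι-0) (trans (ℚ.*-zeroˡ (share v 0)) (sym (gain-0 v)))
  share-pred v (suc l) = ι-recip-cancel l (gain v (suc l))

  laterCount : Fin n → (Fin n → Bool) → ℕ
  laterCount v S = length (later v S)

  E : (Coloring G → ℚ) → ℚ
  E = mean (allFuns n K)

  -- `v` and its later neighbours are distinct vertices, as the graph has no loops, so
  -- `mean-restrict` leaves only the number of colours involved.
  E-cost : ∀ v S → E (cost v (later v S)) ≡ gain v (suc (laterCount v S)) - gain v (laterCount v S)
  E-cost v S = begin
    E (cost v Us)       ≡⟨ mean-*ˡ (allFuns n K) (ι K) _ ⟩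
    ι K · E (λ χ → potential v (map χ (v ∷ Us)) - potential v (map χ Us))
      ≡⟨ cong (ι K ·_) (mean-- (allFuns n K) (λ χ → potential v (map χ (v ∷ Us))) (λ χ → potential v (map χ Us))) ⟩
    ι K · (E (λ χ → potential v (map χ (v ∷ Us))) - E (λ χ → potential v (map χ Us)))
      ≡⟨ cong₂ (λ x y → ι K · (x - y)) (mean-restrict (v∉Us ∷ Us!) (potential v)) (mean-restrict Us! (potential v)) ⟩
    ι K · (expectedPotential v (suc l) - expectedPotential v l)
      ≡⟨ solve 4 (λ k x y z → k ⊛ (x ⊝ y) ⊜ k ⊛ (x ⊝ z) ⊝ k ⊛ (y ⊝ z)) refl
           (ι K) (expectedPotential v (suc l)) (expectedPotential v l) (expectedPotential v 0) ⟩
    gain v (suc l) - gain v l ∎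
    where
    open ≡-Reasoning
    Us = later v S
    l = laterCount v S
    Us! : Unique Us
    Us! = sel-unique (λ u → adj G v u ∧ S u)
    v∉Us : All.All (v ≢_) Us
    v∉Us = All.tabulate (λ u∈ v≡u → adj⇒≢ (proj₁ (∧⁻ (∈-sel⁻ _ u∈))) (sym v≡u))

  laterCount-∖ : ∀ w v S → laterCount w (S ∖ v) ≡ (if adj G w v ∧ S v then ℕ.pred (laterCount w S) else laterCount w S)
  laterCount-∖ w v S = trans (size-cong (λ u → sym (Bool.∧-assoc (adj G w u) (S u) _))) (invert (adj G w v ∧ S v) (size-∖ (λ u → adj G w u ∧ S u) v))
    where
    invert : ∀ b {x y} → x ≡ (if b then suc y else y) → y ≡ (if b then ℕ.pred x else x)
    invert true  refl = refl
    invert false refl = refl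

  -- Among the members of `S`, `w` itself drops out, the removal of one of its l neighbours in `S`
  -- leaves `share w (l - 1)`, and any other removal leaves `share w l`. By `share-pred` the first
  -- kind adds up to `gain w l`.
  share-sum : ∀ w S → S w ≡ true →
    ∑ (allFin n) (λ v → ⟦ S v ⟧ · (⟦ (S ∖ v) w ⟧ · share w (laterCount w (S ∖ v))))
    ≡ ι (size S) · share w (laterCount w S) - share w (laterCount w S) + (gain w (laterCount w S) - ι (laterCount w S) · share w (laterCount w S))
  share-sum w S Sw = begin
    ∑ (allFin n) (λ v → ⟦ S v ⟧ · (⟦ (S ∖ v) w ⟧ · share w (laterCount w (S ∖ v)))) ≡⟨ ∑-cong (allFin n) term ⟩
    ∑ (allFin n) (λ v → ⟦ S v ⟧ · x + ⟦ does (v Fin.≟ w) ⟧ · - x + ⟦ adj G w v ∧ S v ⟧ · (y - x))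
      ≡⟨ ∑-+ (allFin n) _ _ ⟩
    ∑ (allFin n) (λ v → ⟦ S v ⟧ · x + ⟦ does (v Fin.≟ w) ⟧ · - x) + ∑ (allFin n) (λ v → ⟦ adj G w v ∧ S v ⟧ · (y - x))
      ≡⟨ cong₂ _+_ (∑-+ (allFin n) _ _) (∑-size (λ v → adj G w v ∧ S v) (y - x)) ⟩
    ∑ (allFin n) (λ v → ⟦ S v ⟧ · x) + ∑ (allFin n) (λ v → ⟦ does (v Fin.≟ w) ⟧ · - x) + ι l · (y - x)
      ≡⟨ cong (λ z → z + ι l · (y - x)) (cong₂ _+_ (∑-size S x) (∑-single w (λ _ → - x))) ⟩
    ι (size S) · x + - x + ι l · (y - x)
      ≡⟨ solve 4 (λ s x l y → (s ⊛ x ⊝ x) ⊕ l ⊛ (y ⊝ x) ⊜ (s ⊛ x ⊝ x) ⊕ (l ⊛ y ⊝ l ⊛ x)) refl (ι (size S)) x (ι l) y ⟩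
    ι (size S) · x - x + (ι l · y - ι l · x)   ≡⟨ cong (λ z → ι (size S) · x - x + (z - ι l · x)) (share-pred w l) ⟩
    ι (size S) · x - x + (gain w l - ι l · x) ∎
    where
    open ≡-Reasoning
    l = laterCount w S
    x = share w l
    y = share w (ℕ.pred l)

    ∑-size : ∀ (P : Fin n → Bool) c → ∑ (allFin n) (λ v → ⟦ P v ⟧ · c) ≡ ι (size P) · c
    ∑-size P c = trans (∑-*ʳ (allFin n) c (λ v → ⟦ P v ⟧)) (cong (_· c) (sym (ι-size P)))

    does-sym : ∀ v → does (w Fin.≟ v) ≡ does (v Fin.≟ w)
    does-sym v with w Fin.≟ v
    ... | yes w≡v = sym (dec-true (v Fin.≟ w) (sym w≡v))
    ... | no  w≢v = sym (dec-false (v Fin.≟ w) (w≢v ∘ sym))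

    term : ∀ v → ⟦ S v ⟧ · (⟦ (S ∖ v) w ⟧ · share w (laterCount w (S ∖ v)))
               ≡ ⟦ S v ⟧ · x + ⟦ does (v Fin.≟ w) ⟧ · - x + ⟦ adj G w v ∧ S v ⟧ · (y - x)
    term v = trans (cong₂ (λ q k → ⟦ S v ⟧ · (⟦ q ⟧ · share w k)) (cong₂ (λ p e → p ∧ not e) Sw (does-sym v)) (laterCount-∖ w v S))
      (trans (cong (λ z → ⟦ S v ⟧ · (⟦ not (does (v Fin.≟ w)) ⟧ · z)) (Bool.if-float (share w) (adj G w v ∧ S v)))
        (indicator-split (S v) (adj G w v) (does (v Fin.≟ w)) x y self))
      where
      self : does (v Fin.≟ w) ≡ true → S v ≡ true × adj G w v ≡ false
      self eq with refl ← does⇒ (v Fin.≟ w) eq = Sw , adj-irrefl G w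

  -- Condition on the vertex v drawn first: it pays the increment given by `E-cost`, and the
  -- induction hypothesis for `S ∖ v` gives the shares of the others. Interchanging the two sums
  -- collects the contributions of each w, which `balance` evaluates.
  E-sweepCost≤ : ∀ m S → size S ≡ m → E (sweepCost m S) ≤ ∑ (allFin n) (λ v → ⟦ S v ⟧ · share v (laterCount v S))
  E-sweepCost≤ zero    S |S|≡0 = ≤-reflexive (trans (mean-allFuns-const n Δ 0ℚ) (sym (begin
    ∑ (allFin n) (λ v → ⟦ S v ⟧ · share v (laterCount v S)) ≡⟨ sym (∑-filter S (allFin n) (λ v → share v (laterCount v S))) ⟩
    ∑ (sel S) (λ v → share v (laterCount v S))              ≡⟨ empty (sel S) |S|≡0 ⟩
    0ℚ                                                      ∎)))
    where
    open ≡-Reasoning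
    empty : ∀ (us : List (Fin n)) {f : Fin n → ℚ} → length us ≡ 0 → ∑ us f ≡ 0ℚ
    empty [] _ = refl
  E-sweepCost≤ (suc m) S |S|≡1+m = ι-cancel-≤ m (begin
    ι (suc m) · E (sweepCost (suc m) S)
      ≡⟨ cong (ι (suc m) ·_) (mean-*ˡ (allFuns n K) (recip m) _) ⟩
    ι (suc m) · (recip m · E (λ χ → ∑ (allFin n) (λ v → ⟦ S v ⟧ · (cost v (later v S) χ + sweepCost m (S ∖ v) χ))))
      ≡⟨ ι-recip-cancel m _ ⟩
    E (λ χ → ∑ (allFin n) (λ v → ⟦ S v ⟧ · (cost v (later v S) χ + sweepCost m (S ∖ v) χ)))
      ≡⟨ mean-∑ (allFuns n K) (allFin n) _ ⟩
    ∑ (allFin n) (λ v → E (λ χ → ⟦ S v ⟧ · (cost v (later v S) χ + sweepCost m (S ∖ v) χ)))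
      ≡⟨ ∑-cong (allFin n) (λ v → trans (mean-*ˡ (allFuns n K) ⟦ S v ⟧ _)
           (cong (⟦ S v ⟧ ·_) (mean-+ (allFuns n K) (cost v (later v S)) (sweepCost m (S ∖ v))))) ⟩
    ∑ (allFin n) (λ v → ⟦ S v ⟧ · (E (cost v (later v S)) + E (sweepCost m (S ∖ v))))
      ≤⟨ ∑-mono (allFin n) term≤ ⟩
    ∑ (allFin n) (λ v → ⟦ S v ⟧ · c v + ∑ (allFin n) (λ w → p v w))
      ≡⟨ ∑-+ (allFin n) (λ v → ⟦ S v ⟧ · c v) (λ v → ∑ (allFin n) (λ w → p v w)) ⟩
    ∑ (allFin n) (λ v → ⟦ S v ⟧ · c v) + ∑ (allFin n) (λ v → ∑ (allFin n) (λ w → p v w))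
      ≡⟨ cong (λ z → ∑ (allFin n) (λ v → ⟦ S v ⟧ · c v) + z) (∑-swap (allFin n) (allFin n) p) ⟩
    ∑ (allFin n) (λ v → ⟦ S v ⟧ · c v) + ∑ (allFin n) (λ w → ∑ (allFin n) (λ v → p v w))
      ≡⟨ sym (∑-+ (allFin n) (λ v → ⟦ S v ⟧ · c v) (λ w → ∑ (allFin n) (λ v → p v w))) ⟩
    ∑ (allFin n) (λ w → ⟦ S w ⟧ · c w + ∑ (allFin n) (λ v → p v w))
      ≡⟨ ∑-cong (allFin n) balance ⟩
    ∑ (allFin n) (λ w → ι (suc m) · (⟦ S w ⟧ · share w (laterCount w S)))
      ≡⟨ ∑-*ˡ (allFin n) (ι (suc m)) _ ⟩
    ι (suc m) · ∑ (allFin n) (λ w → ⟦ S w ⟧ · share w (laterCount w S)) ∎)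
    where
    open ≤-Reasoning
    c : Fin n → ℚ
    c v = gain v (suc (laterCount v S)) - gain v (laterCount v S)
    p : Fin n → Fin n → ℚ
    p v w = ⟦ S v ⟧ · (⟦ (S ∖ v) w ⟧ · share w (laterCount w (S ∖ v)))

    term≤ : ∀ v → ⟦ S v ⟧ · (E (cost v (later v S)) + E (sweepCost m (S ∖ v))) ≤ ⟦ S v ⟧ · c v + ∑ (allFin n) (λ w → p v w)
    term≤ v = bound (S v) refl
      where
      q : Fin n → ℚ
      q w = ⟦ (S ∖ v) w ⟧ · share w (laterCount w (S ∖ v))
      bound : ∀ s → S v ≡ s → ⟦ s ⟧ · (E (cost v (later v S)) + E (sweepCost m (S ∖ v))) ≤ ⟦ s ⟧ · c v + ∑ (allFin n) (λ w → ⟦ s ⟧ · q w)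
      bound false Sv = ≤-reflexive (trans (ℚ.*-zeroˡ (E (cost v (later v S)) + E (sweepCost m (S ∖ v)))) (sym (trans
        (cong₂ _+_ (ℚ.*-zeroˡ (c v)) (trans (∑-*ˡ (allFin n) 0ℚ q) (ℚ.*-zeroˡ (∑ (allFin n) q)))) (ℚ.+-identityˡ 0ℚ))))
      bound true  Sv = begin
        1ℚ · (E (cost v (later v S)) + E (sweepCost m (S ∖ v))) ≡⟨ ℚ.*-identityˡ _ ⟩
        E (cost v (later v S)) + E (sweepCost m (S ∖ v))
          ≤⟨ +-mono-≤ (≤-reflexive (E-cost v S)) (E-sweepCost≤ m (S ∖ v) (size-∖-∈ S v Sv |S|≡1+m)) ⟩
        c v + ∑ (allFin n) q
          ≡⟨ cong₂ _+_ (sym (ℚ.*-identityˡ (c v))) (∑-cong (allFin n) (λ w → sym (ℚ.*-identityˡ (q w)))) ⟩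
        1ℚ · c v + ∑ (allFin n) (λ w → 1ℚ · q w) ∎

    -- With x the share of a member w, being drawn first contributes (l + 1) x - gain w l, and by
    -- `share-sum` all other draws contribute (|S| - 1) x + gain w l - l x. The total is |S| x.
    balance : ∀ w → ⟦ S w ⟧ · c w + ∑ (allFin n) (λ v → p v w) ≡ ι (suc m) · (⟦ S w ⟧ · share w (laterCount w S))
    balance w = go (S w) refl
      where
      module ≡ = ≡-Reasoning
      l = laterCount w S
      x = share w l
      absent : ∀ v → S w ≡ false → p v w ≡ 0ℚ
      absent v Sw = trans
        (cong (λ s → ⟦ S v ⟧ · (⟦ s ∧ not (does (w Fin.≟ v)) ⟧ · share w (laterCount w (S ∖ v)))) Sw)
        (trans (cong (⟦ S v ⟧ ·_) (ℚ.*-zeroˡ (share w (laterCount w (S ∖ v))))) (ℚ.*-zeroʳ ⟦ S v ⟧))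
      go : ∀ s → S w ≡ s → ⟦ s ⟧ · c w + ∑ (allFin n) (λ v → p v w) ≡ ι (suc m) · (⟦ s ⟧ · x)
      go false Sw = ≡.begin
        0ℚ · c w + ∑ (allFin n) (λ v → p v w)
          ≡.≡⟨ cong (λ z → 0ℚ · c w + z) (trans (∑-cong (allFin n) (λ v → absent v Sw)) (∑-0 (allFin n))) ⟩
        0ℚ · c w + 0ℚ
          ≡.≡⟨ solve 3 (λ g i x → con 0ℚ ⊛ g ⊕ con 0ℚ ⊜ i ⊛ (con 0ℚ ⊛ x)) refl (c w) (ι (suc m)) x ⟩
        ι (suc m) · (0ℚ · x)   ≡.∎
      go true Sw = ≡.begin
        1ℚ · c w + ∑ (allFin n) (λ v → p v w)
          ≡.≡⟨ cong (λ z → 1ℚ · c w + z) (share-sum w S Sw) ⟩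
        1ℚ · c w + (ι (size S) · x - x + (gain w l - ι l · x))
          ≡.≡⟨ cong₂ (λ s g → 1ℚ · (g - gain w l) + (ι s · x - x + (gain w l - ι l · x))) |S|≡1+m
                (trans (sym (share-pred w (suc l))) (cong (_· x) (ι-suc l))) ⟩
        1ℚ · ((1ℚ + ι l) · x - gain w l) + (ι (suc m) · x - x + (gain w l - ι l · x))
          ≡.≡⟨ solve 4 (λ l x g s → con 1ℚ ⊛ ((con 1ℚ ⊕ l) ⊛ x ⊝ g) ⊕ ((s ⊛ x ⊝ x) ⊕ (g ⊝ l ⊛ x)) ⊜ s ⊛ (con 1ℚ ⊛ x)) refl
                (ι l) x (gain w l) (ι (suc m)) ⟩
        ι (suc m) · (1ℚ · x)   ≡.∎

  -- Since dup is at most the length, the potential of d + 1 colours is at most H(K). In K (H(K) -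
  -- H(a)) the factor K splits as a + (d + 1): the first part contributes at most d + 1 by
  -- `harmonic-gap`, the second at most (d + 1) H(K), and the common factor d + 1 cancels.
  share≤ : ∀ v → share v (degree G v) ≤ 1ℚ + harmonic K
  share≤ v = ι-cancel-≤ d (begin
    ι (suc d) · share v d                      ≡⟨ ι-recip-cancel d (gain v (suc d)) ⟩
    ι K · (expectedPotential v (suc d) - expectedPotential v 0)
      ≤⟨ *-monoˡ (0≤ι K) (ℚ.+-monoˡ-≤ (- expectedPotential v 0) full) ⟩
    ι K · (harmonic (a ℕ.+ suc d) - harmonic (a ℕ.+ 0))
      ≡⟨ cong₂ (λ k j → ι k · (harmonic (a ℕ.+ suc d) - harmonic j)) (sym K≡) (ℕ.+-identityʳ a) ⟩
    ι (a ℕ.+ suc d) · (harmonic (a ℕ.+ suc d) - harmonic a)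
      ≡⟨ cong (_· (harmonic (a ℕ.+ suc d) - harmonic a)) (ι-+ a (suc d)) ⟩
    (ι a + ι (suc d)) · (harmonic (a ℕ.+ suc d) - harmonic a)
      ≡⟨ ℚ.*-distribʳ-+ _ (ι a) (ι (suc d)) ⟩
    ι a · (harmonic (a ℕ.+ suc d) - harmonic a) + ι (suc d) · (harmonic (a ℕ.+ suc d) - harmonic a)
      ≤⟨ +-mono-≤ (harmonic-gap a (suc d)) (*-monoˡ (0≤ι (suc d)) drop) ⟩
    ι (suc d) + ι (suc d) · harmonic (a ℕ.+ suc d)
      ≡⟨ solve 2 (λ i h → i ⊕ i ⊛ h ⊜ i ⊛ (con 1ℚ ⊕ h)) refl (ι (suc d)) (harmonic (a ℕ.+ suc d)) ⟩
    ι (suc d) · (1ℚ + harmonic (a ℕ.+ suc d))  ≡⟨ cong (λ k → ι (suc d) · (1ℚ + harmonic k)) K≡ ⟩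
    ι (suc d) · (1ℚ + harmonic K)              ∎)
    where
    open ≤-Reasoning
    d = degree G v
    a = slack v
    K≡ : a ℕ.+ suc d ≡ K
    K≡ = trans (ℕ.+-suc a d) (cong suc (ℕ.m∸n+n≡m (degree≤Δ v)))
    full : expectedPotential v (suc d) ≤ harmonic (a ℕ.+ suc d)
    full = meanSeq-≤ (suc d) (λ cs eq → harmonic-mono (ℕ.+-monoʳ-≤ a (ℕ.≤-trans (dup≤length cs) (ℕ.≤-reflexive eq))))
    drop : harmonic (a ℕ.+ suc d) - harmonic a ≤ harmonic (a ℕ.+ suc d)
    drop = ≤-trans (ℚ.+-monoʳ-≤ (harmonic (a ℕ.+ suc d)) (ℚ.neg-antimono-≤ (harmonic-nonNeg a)))
                   (≤-reflexive (ℚ.+-identityʳ (harmonic (a ℕ.+ suc d))))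

  -- The sweep starts from the set of all vertices, so the count of neighbours in the set is the
  -- full degree and `share≤` applies.
  E-outer≤ : ∀ k → truncatedExpectedRecolorings G k ≤ ι n · (1ℚ + harmonic K)
  E-outer≤ k = begin
    E (outer G k)          ≤⟨ mean-mono (allFuns n K) (λ χ → outer≤sweepCost n k all χ size-all (λ _ _ → refl)) ⟩
    E (sweepCost n all)    ≤⟨ E-sweepCost≤ n all size-all ⟩
    ∑ (allFin n) (λ v → 1ℚ · share v (laterCount v all))
      ≤⟨ ∑-mono (allFin n) (λ v → ≤-trans (≤-reflexive (trans (ℚ.*-identityˡ _)
           (cong (share v) (size-cong (λ u → Bool.∧-identityʳ (adj G v u)))))) (share≤ v)) ⟩
    ∑ (allFin n) (λ _ → 1ℚ + harmonic K)      ≡⟨ ∑-const (allFin n) (1ℚ + harmonic K) ⟩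
    ι (length (allFin n)) · (1ℚ + harmonic K) ≡⟨ cong (λ l → ι l · (1ℚ + harmonic K)) (List.length-tabulate {n = n} id) ⟩
    ι n · (1ℚ + harmonic K)                   ∎
    where
    open ≤-Reasoning
    all : Fin n → Bool
    all _ = true
    size-all : size all ≡ n
    size-all = trans (cong length (List.filter-all (λ u → all u Bool.≟ true) (All.tabulate {xs = allFin n} (λ _ → refl))))
                     (List.length-tabulate {n = n} id)

-- The bound is uniform in the budget k. By monotone convergence it passes to the untruncated
-- expectation, whose finiteness entails termination with probability 1.
theorem1 : ∃ λ (C : ℕ) → ∀ (n : ℕ) (G : Graph n) (k : ℕ) →
    truncatedExpectedRecolorings G k
    ≤ ((+ (C * n * suc ⌊log₂ maxDegree G ⌋)) / 1)
-- Per vertex there is 1 from `share≤`, 1 + log Δ from H(Δ), and at most 1 from the last term of H(Δ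
-- + 1); the sum 3 + log Δ is at most 3 (1 + log Δ).
theorem1 = 3 , λ n G k →
  let Δ = maxDegree G
      L = ⌊log₂ Δ ⌋
  in begin
    truncatedExpectedRecolorings G k       ≤⟨ E-outer≤ G k ⟩
    ι n · (1ℚ + (harmonic Δ + recip Δ))
      ≤⟨ *-monoˡ (0≤ι n) (ℚ.+-monoʳ-≤ 1ℚ (+-mono-≤ (harmonic≤1+log Δ) (≤-trans (recip-antitone {0} {Δ} ℕ.z≤n) (≤-reflexive recip-0)))) ⟩
    ι n · (1ℚ + (ι (suc L) + 1ℚ))          ≡⟨ cong (ι n ·_) (trans (cong (λ z → 1ℚ + z) (trans (cong (λ z → ι (suc L) + z) (sym ι-1)) (sym (ι-+ (suc L) 1)))) (sym (ι-suc (suc L ℕ.+ 1)))) ⟩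
    ι n · ι (suc (suc L ℕ.+ 1))            ≤⟨ *-monoˡ (0≤ι n) (ι-mono (3+L≤ L)) ⟩
    ι n · ι (3 * suc L)                    ≡⟨ sym (ι-* n (3 * suc L)) ⟩
    ι (n * (3 * suc L))                    ≡⟨ cong ι (trans (sym (ℕ.*-assoc n 3 (suc L))) (cong (_* suc L) (ℕ.*-comm n 3))) ⟩
    ι (3 * n * suc L)                      ≡⟨ ι≡/1 (3 * n * suc L) ⟩
    (+ (3 * n * suc L)) / 1                ∎
  where
  open ≤-Reasoning
  3+L≤ : ∀ L → suc (suc L ℕ.+ 1) ℕ.≤ 3 * suc L
  3+L≤ L = ℕ.≤-trans (ℕ.≤-reflexive (trans (ℕ.+-comm 1 (suc L ℕ.+ 1)) (ℕ.+-assoc (suc L) 1 1)))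
    (ℕ.+-monoʳ-≤ (suc L) (ℕ.+-mono-≤ {1} {suc L} {1} (ℕ.s≤s ℕ.z≤n) (ℕ.s≤s ℕ.z≤n)))
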